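{- Let $P$ be a $k$-neighborly $d$-polytope with $2k < d \le 3k - 1$. Then $f_{d-1}(P) \ge f_{0}(P)$, and the equality is attained only if $P$ is a simplex.
   Context: A $d$-polytope is a $d$-dimensional convex polytope; $f_i(P)$ is the number of $i$-dimensional faces of $P$. For an integer $k$, $P$ is $k$-neighborly if every set of $k$ vertices of $P$ is the vertex set of some face of $P$. -}

module Defs where

open import Level using (Level; _⊔_; suc)
open import Data.Nat using (ℕ; zero) renaming (suc to sucℕ)
open import Data.Fin using (Fin)
import Data.Fin as F
open import Data.Fin.Subset using (Subset; _∈_; ⁅_⁆; ⊤)
open import Data.Product using (Σ; ∃; ∃-syntax; _×_; _,_)
open import Relation.Nullary using (¬_)
open import Relation.Binary.Core using (Rel)
open import Relation.Binary.Structures using (IsTotalOrder)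
open import Function.Definitions using (Injective)
open import Function.Bundles using (_⇔_)
open import Relation.Binary.PropositionalEquality using (_≡_)
open import Algebra.Bundles using (CommutativeRing)

-- Ordered fields (ℝ is one; convex polytopes are taken with
-- coordinates in an arbitrary ordered field).

record OrderedField (c ℓ₁ ℓ₂ : Level) : Set (Level.suc (c ⊔ ℓ₁ ⊔ ℓ₂)) where
  field
    commutativeRing : CommutativeRing c ℓ₁
  open CommutativeRing commutativeRing public
  field
    _≤_            : Rel Carrier ℓ₂
    isTotalOrder   : IsTotalOrder _≈_ _≤_
    +-mono-≤       : ∀ {x y} z → x ≤ y → (x + z) ≤ (y + z)
    *-nonneg       : ∀ {x y} → 0# ≤ x → 0# ≤ y → 0# ≤ (x * y)
    0≉1            : ¬ (0# ≈ 1#)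
    inverse        : ∀ x → ¬ (x ≈ 0#) → ∃[ y ] ((x * y) ≈ 1#)

module Polytopes {c ℓ₁ ℓ₂} (K : OrderedField c ℓ₁ ℓ₂) where
  open OrderedField K

  Σ[_] : ∀ {m} → (Fin m → Carrier) → Carrier
  Σ[_] {zero}   f = 0#
  Σ[_] {sucℕ m} f = f F.zero + Σ[ (λ i → f (F.suc i)) ]

  Point : ℕ → Set c
  Point d = Fin d → Carrier

  _·_ : ∀ {d} → Point d → Point d → Carrier
  a · x = Σ[ (λ j → a j * x j) ]

  AffinelyIndependent : ∀ {m d} → (Fin m → Point d) → Set (c ⊔ ℓ₁)
  AffinelyIndependent {m} {d} x =
    (λ' : Fin m → Carrier) → Σ[ λ' ] ≈ 0# →
    (∀ (j : Fin d) → Σ[ (λ i → λ' i * x i j) ] ≈ 0#) →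
    ∀ i → λ' i ≈ 0#

  -- A point configuration V : Fin n → Point d; P = conv(V).
  module _ {n d : ℕ} (V : Fin n → Point d) where

    HasAffIndep : Subset n → ℕ → Set (c ⊔ ℓ₁)
    HasAffIndep S r = Σ (Fin r → Fin n) λ g →
      Injective _≡_ _≡_ g × (∀ t → g t ∈ S) × AffinelyIndependent (λ t → V (g t))

    -- S is the set of (indices of) points of V lying on some face of P:
    -- there is a valid inequality a·x ≤ b on P whose equality set in V is S.
    IsFaceSet : Subset n → Set (c ⊔ ℓ₁ ⊔ ℓ₂)
    IsFaceSet S = Σ (Point d) λ a → Σ Carrier λ b →
      (∀ i → (a · V i) ≤ b) × (∀ i → ((a · V i) ≈ b) ⇔ (i ∈ S))

    -- every point V i is a vertex of P (so the vertices of P are exactly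
    -- V 0, …, V (n-1), pairwise distinct, and f₀(P) = n)
    AllVertices : Set (c ⊔ ℓ₁ ⊔ ℓ₂)
    AllVertices = ∀ i → IsFaceSet ⁅ i ⁆

    FullDim : Set (c ⊔ ℓ₁)
    FullDim = HasAffIndep ⊤ (sucℕ d)

    IsFacet : Subset n → Set (c ⊔ ℓ₁ ⊔ ℓ₂)
    IsFacet S = IsFaceSet S × HasAffIndep S d × ¬ HasAffIndep S (sucℕ d)

    Neighborly : ℕ → Set (c ⊔ ℓ₁ ⊔ ℓ₂)
    Neighborly k = ∀ (S : Subset n) → Data.Fin.Subset.∣ S ∣ ≡ k → IsFaceSet S

{-# OPTIONS --safe #-}
-- Work in homogeneous coordinates, D = d + 1. Call a k-set T of facets small if
-- at most D - k vertices lie on all of them. Facet normals through a k-set A of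
-- vertices span the annihilator of A, so A lies on D - k facets with independent
-- normals; any k of these meet in rank at most D - k ≤ 2k, hence (Radon) in at
-- most D - k vertices. Counting pairs (A , T), A on all facets of the small T:
--   C(n , k) C(D - k , k) ≤ #pairs ≤ C(m , k) C(D - k , k),
-- where m is the number of facets, so n ≤ m. If n = m, then every k-set lies on
-- exactly D - k facets, i.e. P is simple along its (k - 1)-faces; as the
-- (k + 1)-faces are simplices too, the neighbours of one such face exhaust the
-- vertices and n = D.
--
-- Equality in an ordered field is not decidable here, so existence statements
-- are proved under double negation; the final goals are stable.
module Submission where

open import Defs

-- Two obstacles shape the argument. Some k facets through a k-set may have dependent normals and
-- share more than D - k vertices, so a count of all of them would have no useful upper bound; the
-- restriction to small sets caps the count on one side, and independent normals still supply enough
-- small sets on the other. Also, no face lattice is available: a facet is recognised only as the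
-- zero set of a supporting functional that contains d independent vertices. Facets are therefore
-- produced by rotating a supporting functional until it meets a new vertex, the amount of turning
-- being fixed by a maximal ratio. Meanwhile a prescribed vector is kept outside the kernel of the
-- functional; this yields normals independent of earlier ones, edges, and facets that miss a given
-- vertex. Independence of normals is certified by dual vectors instead of ranks, which could not be
-- computed without deciding equality. In the case of equality, connectivity of the graph is
-- avoided: the signs of a single hypothetical dependency are determined facet by facet.

module FiniteSets where

  open import Data.Empty using (⊥-elim)
  open import Data.Fin using (Fin; zero; suc)
  import Data.Fin.Properties as Fin
  open import Data.Fin.Subset
  open import Data.Fin.Subset.Properties
  open import Data.Nat using (ℕ; zero; suc; _+_; _*_; _≤_; _<_; z≤n; s≤s; _≤?_; >-nonZero)
  open import Data.Nat.Combinatorics using (_C_; nCk+nC[k+1]≡[n+1]C[k+1]; nCk≡nC[n∸k]; nCn≡1)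
  open import Data.Nat.Properties
  open import Data.Product using (∃; _×_; _,_; proj₁; proj₂)
  open import Data.Sum using (_⊎_; inj₁; inj₂; [_,_]′)
  open import Data.Vec using ([]; _∷_; tabulate; here; there)
  open import Data.Vec.Properties using ([]=⇒lookup; lookup⇒[]=; lookup∘tabulate)
  open import Function using (_∘_; id)
  open import Function.Definitions using (Injective)
  open import Relation.Binary.PropositionalEquality
  open import Relation.Nullary using (¬_; Dec; yes; no; does; contradiction)
  open import Relation.Nullary.Decidable using (dec-true; _×-dec_; decidable-stable)
  open import Relation.Unary using (Decidable)

  -- Finite subsets.

  private
    variable
      n m k l : ℕ

  subset : ∀ {p} {P : Fin n → Set p} → Decidable P → Subset n
  subset P? = tabulate (does ∘ P?)

  ∈-subset⁺ : ∀ {p} {P : Fin n → Set p} (P? : Decidable P) {i} → P i → i ∈ subset P?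
  ∈-subset⁺ P? {i} Pi = lookup⇒[]= i _ (trans (lookup∘tabulate _ i) (dec-true (P? i) Pi))

  ∈-subset⁻ : ∀ {p} {P : Fin n → Set p} (P? : Decidable P) {i} → i ∈ subset P? → P i
  ∈-subset⁻ P? {i} i∈ with P? i in eq
  ... | yes Pi = Pi
  ... | no ¬Pi with () ← trans (sym ([]=⇒lookup i∈)) (trans (lookup∘tabulate _ i) (cong does eq))

  enumerate : (S : Subset n) → ∃ λ (e : Fin ∣ S ∣ → Fin n) →
    Injective _≡_ _≡_ e × (∀ t → e t ∈ S) × (∀ {x} → x ∈ S → ∃ λ t → e t ≡ x)
  enumerate [] = (λ ()) , (λ {}) , (λ ()) , λ ()
  enumerate (outside ∷ S) with enumerate S
  ... | e , inj , mem , onto =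
    suc ∘ e , inj ∘ Fin.suc-injective , there ∘ mem ,
    λ where (there x∈) → let t , eq = onto x∈ in t , cong suc eq
  enumerate {suc n} (inside ∷ S) with enumerate S
  ... | e , inj , mem , onto = e′ , inj′ , mem′ , onto′
    where
    e′ : Fin (suc ∣ S ∣) → Fin (suc n)
    e′ zero    = zero
    e′ (suc t) = suc (e t)
    inj′ : Injective _≡_ _≡_ e′
    inj′ {zero}  {zero}  _  = refl
    inj′ {suc _} {suc _} eq = cong suc (inj (Fin.suc-injective eq))
    mem′ : ∀ t → e′ t ∈ inside ∷ S
    mem′ zero    = here
    mem′ (suc t) = there (mem t)
    onto′ : ∀ {x} → x ∈ inside ∷ S → ∃ λ t → e′ t ≡ x
    onto′ here       = zero , refl
    onto′ (there x∈) = let t , eq = onto x∈ in suc t , cong suc eq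

  injection⇒≤∣∣ : (S : Subset n) (f : Fin l → Fin n) → Injective _≡_ _≡_ f →
    (∀ t → f t ∈ S) → l ≤ ∣ S ∣
  injection⇒≤∣∣ S f f-inj f∈S with enumerate S
  ... | e , _ , _ , onto = Fin.injective⇒≤ {f = λ t → proj₁ (onto (f∈S t))} λ {s} {t} eq →
    f-inj (trans (sym (proj₂ (onto (f∈S s)))) (trans (cong e eq) (proj₂ (onto (f∈S t)))))

  ∣∣<n⇒∃∉ : (S : Subset n) → ∣ S ∣ < n → ∃ λ x → x ∉ S
  ∣∣<n⇒∃∉ {n} S S<n = Fin.¬∀⟶∃¬ n (_∈ S) (_∈? S) λ all∈S →
    <⇒≱ S<n (subst (_≤ ∣ S ∣) (∣⊤∣≡n n) (p⊆q⇒∣p∣≤∣q∣ {p = ⊤} λ {x} _ → all∈S x))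

  interpolate : (S R : Subset n) → S ⊆ R → ∣ S ∣ ≤ k → k ≤ ∣ R ∣ →
    ∃ λ S′ → S ⊆ S′ × S′ ⊆ R × ∣ S′ ∣ ≡ k
  interpolate [] [] S⊆R _ z≤n = [] , id , id , refl
  interpolate (inside ∷ S) (outside ∷ R) S⊆R _ _ with () ← S⊆R here
  interpolate (outside ∷ S) (outside ∷ R) S⊆R S≤k k≤R =
    let S′ , ⊆₁ , ⊆₂ , eq = interpolate S R (drop-∷-⊆ S⊆R) S≤k k≤R
    in outside ∷ S′ , s⊆s ⊆₁ , s⊆s ⊆₂ , eq
  interpolate (inside ∷ S) (inside ∷ R) S⊆R (s≤s S≤k) (s≤s k≤R) =
    let S′ , ⊆₁ , ⊆₂ , eq = interpolate S R (drop-∷-⊆ S⊆R) S≤k k≤R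
    in inside ∷ S′ , s⊆s ⊆₁ , s⊆s ⊆₂ , cong suc eq
  interpolate {k = k} (outside ∷ S) (inside ∷ R) S⊆R S≤k k≤R with k ≤? ∣ R ∣
  ... | yes k≤R′ =
    let S′ , ⊆₁ , ⊆₂ , eq = interpolate S R (drop-∷-⊆ S⊆R) S≤k k≤R′
    in outside ∷ S′ , s⊆s ⊆₁ , out⊆ ⊆₂ , eq
  ... | no k≰R = inside ∷ R , out⊆ (drop-∷-⊆ S⊆R) , id , ≤-antisym (≰⇒> k≰R) k≤R

  insert : Fin n → Subset n → Subset n
  insert x S = ⁅ x ⁆ ∪ S

  ∈-insert⁻ : ∀ {x y} {S : Subset n} → y ∈ insert x S → y ≡ x ⊎ y ∈ S
  ∈-insert⁻ {x = x} y∈ with x∈p∪q⁻ _ _ y∈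
  ... | inj₁ y∈x = inj₁ (x∈⁅y⁆⇒x≡y x y∈x)
  ... | inj₂ y∈S = inj₂ y∈S

  ∈-insertˡ : ∀ {x} {S : Subset n} → x ∈ insert x S
  ∈-insertˡ {x = x} = x∈p∪q⁺ (inj₁ (x∈⁅x⁆ x))

  ∈-insertʳ : ∀ {x} {S : Subset n} → S ⊆ insert x S
  ∈-insertʳ y∈S = x∈p∪q⁺ (inj₂ y∈S)

  ∣insert∣ : ∀ {x} {S : Subset n} → x ∉ S → ∣ insert x S ∣ ≡ suc ∣ S ∣
  ∣insert∣ {x = zero}  {inside  ∷ S} x∉S = ⊥-elim (x∉S here)
  ∣insert∣ {x = zero}  {outside ∷ S} x∉S = cong (suc ∘ ∣_∣) (∪-identityˡ S)
  ∣insert∣ {x = suc x} {inside  ∷ S} x∉S = cong suc (∣insert∣ (x∉S ∘ there))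
  ∣insert∣ {x = suc x} {outside ∷ S} x∉S = ∣insert∣ (x∉S ∘ there)

  insertAll : (Fin l → Fin n) → Subset n → Subset n
  insertAll {zero}  w S = S
  insertAll {suc l} w S = insert (w zero) (insertAll (w ∘ suc) S)

  ∈-insertAll⁻ : ∀ (w : Fin l → Fin n) {S x} → x ∈ insertAll w S → x ∈ S ⊎ ∃ λ i → x ≡ w i
  ∈-insertAll⁻ {zero}  w x∈ = inj₁ x∈
  ∈-insertAll⁻ {suc l} w x∈ with ∈-insert⁻ x∈
  ... | inj₁ eq = inj₂ (zero , eq)
  ... | inj₂ x∈′ with ∈-insertAll⁻ (w ∘ suc) x∈′
  ...   | inj₁ x∈S       = inj₁ x∈S
  ...   | inj₂ (i , eq) = inj₂ (suc i , eq)

  ∣insertAll∣ : ∀ (w : Fin l → Fin n) {S} → Injective _≡_ _≡_ w → (∀ i → w i ∉ S) →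
    ∣ insertAll w S ∣ ≡ l + ∣ S ∣
  ∣insertAll∣ {zero}  w inj w∉S = refl
  ∣insertAll∣ {suc l} w inj w∉S = trans
    (∣insert∣ λ w₀∈ → [ w∉S zero , (λ where (i , eq) → Fin.0≢1+n (inj eq)) ]′ (∈-insertAll⁻ (w ∘ suc) w₀∈))
    (cong suc (∣insertAll∣ (w ∘ suc) (Fin.suc-injective ∘ inj) (w∉S ∘ suc)))

  -- The alternatives may overlap, so the pieces record which one was offered; every index of `S`
  -- goes to exactly one piece and the sizes add up. A dependency is cut by sign in this way
  -- although zero cannot be tested.
  split : ∀ {p} {P Q : Fin n → Set p} → (∀ i → P i ⊎ Q i) → (S : Subset n) →
    ∃ λ S₁ → ∃ λ S₂ → ∣ S₁ ∣ + ∣ S₂ ∣ ≡ ∣ S ∣ ×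
      (∀ {i} → i ∈ S → i ∉ S₁ → Q i) × (∀ {i} → i ∈ S → i ∉ S₂ → P i)
  split P⊎Q [] = [] , [] , refl , (λ ()) , λ ()
  split P⊎Q (s ∷ S) with split (P⊎Q ∘ suc) S
  split P⊎Q (outside ∷ S) | S₁ , S₂ , eq , q , p = outside ∷ S₁ , outside ∷ S₂ , eq ,
    (λ where (there i∈) i∉ → q i∈ (i∉ ∘ there)) ,
    (λ where (there i∈) i∉ → p i∈ (i∉ ∘ there))
  split P⊎Q (inside ∷ S) | S₁ , S₂ , eq , q , p with P⊎Q zero
  ... | inj₁ p₀ = inside ∷ S₁ , outside ∷ S₂ , cong suc eq ,
    (λ where here       i∉ → ⊥-elim (i∉ here)
             (there i∈) i∉ → q i∈ (i∉ ∘ there)) ,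
    (λ where here       i∉ → p₀
             (there i∈) i∉ → p i∈ (i∉ ∘ there))
  ... | inj₂ q₀ = outside ∷ S₁ , inside ∷ S₂ , trans (+-suc _ _) (cong suc eq) ,
    (λ where here       i∉ → q₀
             (there i∈) i∉ → q i∈ (i∉ ∘ there)) ,
    (λ where here       i∉ → ⊥-elim (i∉ here)
             (there i∈) i∉ → p i∈ (i∉ ∘ there))

  -- Binomial coefficients.

  nC0≡1 : ∀ n → n C 0 ≡ 1
  nC0≡1 n = trans (nCk≡nC[n∸k] {0} {n} z≤n) (nCn≡1 n)

  C-pos : k ≤ n → 0 < n C k
  C-pos {zero}  {n}     z≤n = subst (0 <_) (sym (nC0≡1 n)) (s≤s z≤n)
  C-pos {suc k} {suc n} (s≤s k≤n) = subst (0 <_) (nCk+nC[k+1]≡[n+1]C[k+1] n k)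
    (≤-trans (C-pos k≤n) (m≤m+n _ _))

  C-step : ∀ n k → n C k ≤ suc n C k
  C-step n zero    = ≤-reflexive (trans (nC0≡1 n) (sym (nC0≡1 (suc n))))
  C-step n (suc k) = subst (n C suc k ≤_) (nCk+nC[k+1]≡[n+1]C[k+1] n k) (m≤n+m _ _)

  C-mono : ∀ k → m ≤ n → m C k ≤ n C k
  C-mono {m} k m≤n = go (≤⇒≤′ m≤n)
    where
    open import Data.Nat using (_≤′_; ≤′-refl; ≤′-step)
    go : ∀ {n} → m ≤′ n → m C k ≤ n C k
    go ≤′-refl        = ≤-refl
    go (≤′-step m≤′n) = ≤-trans (go m≤′n) (C-step _ k)

  -- By Pascal's rule the last step up to `n` adds a positive binomial once `suc k ≤ n`, so a
  -- smaller `m` would give a strictly smaller value.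
  C-cancel-≤ : suc k ≤ n → n C suc k ≤ m C suc k → n ≤ m
  C-cancel-≤ {k} {suc n} {m} (s≤s k≤n) le with suc n ≤? m
  ... | yes n≤m = n≤m
  ... | no  n≰m = contradiction le (<⇒≱ (begin-strict
    m C suc k           ≤⟨ C-mono (suc k) (≤-pred (≰⇒> n≰m)) ⟩
    n C suc k           <⟨ +-monoˡ-< (n C suc k) (C-pos k≤n) ⟩
    n C k + n C suc k   ≡⟨ nCk+nC[k+1]≡[n+1]C[k+1] n k ⟩
    suc n C suc k       ∎))
    where open ≤-Reasoning

  -- The sum runs over the subsets of size `k` without listing them: it branches on the first
  -- element as Pascal's rule does, so counts become inductions over that rule.
  sumOver : ℕ → (Subset n → ℕ) → ℕ
  sumOver {zero}  zero    f = f []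
  sumOver {zero}  (suc k) f = 0
  sumOver {suc n} zero    f = sumOver zero (f ∘ (outside ∷_))
  sumOver {suc n} (suc k) f = sumOver (suc k) (f ∘ (outside ∷_)) + sumOver k (f ∘ (inside ∷_))

  sumOver-mono : ∀ k {f g : Subset n → ℕ} → (∀ T → ∣ T ∣ ≡ k → f T ≤ g T) →
    sumOver k f ≤ sumOver k g
  sumOver-mono {zero}  zero    f≤g = f≤g [] refl
  sumOver-mono {zero}  (suc k) f≤g = z≤n
  sumOver-mono {suc n} zero    f≤g = sumOver-mono zero λ T eq → f≤g (outside ∷ T) eq
  sumOver-mono {suc n} (suc k) f≤g = +-mono-≤
    (sumOver-mono (suc k) λ T eq → f≤g (outside ∷ T) eq)
    (sumOver-mono k λ T eq → f≤g (inside ∷ T) (cong suc eq))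

  -- A deficit in one term cannot be made up by the others, because those are bounded termwise.
  sumOver-tight : ∀ k {f g : Subset n → ℕ} → (∀ T → ∣ T ∣ ≡ k → f T ≤ g T) →
    sumOver k g ≤ sumOver k f → ∀ T → ∣ T ∣ ≡ k → g T ≤ f T
  sumOver-tight zero    f≤g le [] refl = le
  sumOver-tight zero    f≤g le (outside ∷ T) eq =
    sumOver-tight zero (λ T eq → f≤g (outside ∷ T) eq) le T eq
  sumOver-tight (suc k) f≤g le (outside ∷ T) eq =
    sumOver-tight (suc k) (λ T eq → f≤g (outside ∷ T) eq)
      (+-cancelʳ-≤ _ _ _ (≤-trans le (+-monoʳ-≤ _ (sumOver-mono k λ T eq → f≤g (inside ∷ T) (cong suc eq))))) T eq
  sumOver-tight (suc k) f≤g le (inside ∷ T) eq =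
    sumOver-tight k (λ T eq → f≤g (inside ∷ T) (cong suc eq))
      (+-cancelˡ-≤ _ _ _ (≤-trans le (+-monoˡ-≤ _ (sumOver-mono (suc k) λ T eq → f≤g (outside ∷ T) eq)))) T (suc-injective eq)

  sumOver-const : ∀ n k c → sumOver {n} k (λ _ → c) ≡ (n C k) * c
  sumOver-const zero    zero    c = sym (+-identityʳ c)
  sumOver-const zero    (suc k) c = refl
  sumOver-const (suc n) zero    c = trans (sumOver-const n zero c)
    (cong (_* c) (trans (nC0≡1 n) (sym (nC0≡1 (suc n)))))
  sumOver-const (suc n) (suc k) c = begin
    sumOver {n} (suc k) (λ _ → c) + sumOver {n} k (λ _ → c)
      ≡⟨ cong₂ _+_ (sumOver-const n (suc k) c) (sumOver-const n k c) ⟩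
    (n C suc k) * c + (n C k) * c   ≡⟨ *-distribʳ-+ c (n C suc k) (n C k) ⟨
    (n C suc k + n C k) * c         ≡⟨ cong (_* c) (+-comm (n C suc k) (n C k)) ⟩
    (n C k + n C suc k) * c         ≡⟨ cong (_* c) (nCk+nC[k+1]≡[n+1]C[k+1] n k) ⟩
    (suc n C suc k) * c             ∎
    where open ≡-Reasoning

  sumOver-+ : ∀ k (f g : Subset n → ℕ) →
    sumOver k (λ T → f T + g T) ≡ sumOver k f + sumOver k g
  sumOver-+ {zero}  zero    f g = refl
  sumOver-+ {zero}  (suc k) f g = refl
  sumOver-+ {suc n} zero    f g = sumOver-+ zero (f ∘ (outside ∷_)) (g ∘ (outside ∷_))
  sumOver-+ {suc n} (suc k) f g = trans
    (cong₂ _+_ (sumOver-+ (suc k) (f ∘ (outside ∷_)) (g ∘ (outside ∷_))) (sumOver-+ k (f ∘ (inside ∷_)) (g ∘ (inside ∷_))))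
    (interchange (sumOver (suc k) (f ∘ (outside ∷_))) (sumOver (suc k) (g ∘ (outside ∷_)))
      (sumOver k (f ∘ (inside ∷_))) (sumOver k (g ∘ (inside ∷_))))
    where open import Algebra.Properties.CommutativeSemigroup +-commutativeSemigroup using (interchange)

  sumOver-swap : ∀ k l (f : Subset n → Subset m → ℕ) →
    sumOver k (λ A → sumOver l (f A)) ≡ sumOver l (λ T → sumOver k (λ A → f A T))
  sumOver-swap {zero}      zero    l f = refl
  sumOver-swap {zero}  {m} (suc k) l f = sym (trans (sumOver-const m l 0) (*-zeroʳ (m C l)))
  sumOver-swap {suc n}     zero    l f = sumOver-swap zero l (f ∘ (outside ∷_))
  sumOver-swap {suc n}     (suc k) l f = trans
    (cong₂ _+_ (sumOver-swap (suc k) l (f ∘ (outside ∷_))) (sumOver-swap k l (f ∘ (inside ∷_))))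
    (sym (sumOver-+ l (λ T → sumOver (suc k) (λ A → f (outside ∷ A) T)) (λ T → sumOver k (λ A → f (inside ∷ A) T))))

  C≤sumOver : ∀ k (B : Subset n) {f} → (∀ T → T ⊆ B → ∣ T ∣ ≡ k → 1 ≤ f T) →
    ∣ B ∣ C k ≤ sumOver k f
  C≤sumOver zero    []            1≤f = 1≤f [] id refl
  C≤sumOver (suc k) []            1≤f = z≤n
  C≤sumOver zero    (outside ∷ B) 1≤f = C≤sumOver zero B λ T T⊆B → 1≤f (outside ∷ T) (s⊆s T⊆B)
  C≤sumOver (suc k) (outside ∷ B) 1≤f = ≤-trans
    (C≤sumOver (suc k) B λ T T⊆B → 1≤f (outside ∷ T) (s⊆s T⊆B)) (m≤m+n _ _)
  C≤sumOver zero    (inside ∷ B)  {f} 1≤f = subst (_≤ sumOver zero f) (trans (nC0≡1 ∣ B ∣) (sym (nC0≡1 (suc ∣ B ∣))))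
    (C≤sumOver zero B λ T T⊆B → 1≤f (outside ∷ T) (out⊆ T⊆B))
  C≤sumOver (suc k) (inside ∷ B)  {f} 1≤f = begin
    suc ∣ B ∣ C suc k                ≡⟨ nCk+nC[k+1]≡[n+1]C[k+1] ∣ B ∣ k ⟨
    ∣ B ∣ C k + ∣ B ∣ C suc k        ≡⟨ +-comm (∣ B ∣ C k) _ ⟩
    ∣ B ∣ C suc k + ∣ B ∣ C k        ≤⟨ +-mono-≤
      (C≤sumOver (suc k) B λ T T⊆B → 1≤f (outside ∷ T) (out⊆ T⊆B))
      (C≤sumOver k B λ T T⊆B eq → 1≤f (inside ∷ T) (s⊆s T⊆B) (cong suc eq)) ⟩
    sumOver (suc k) f                ∎
    where open ≤-Reasoning

  sumOver≤C : ∀ k (S : Subset n) {f} → (∀ A → f A ≤ 1) → (∀ A → ¬ A ⊆ S → f A ≡ 0) →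
    sumOver k f ≤ ∣ S ∣ C k
  sumOver≤C zero    []            f≤1 f≡0 = f≤1 []
  sumOver≤C (suc k) []            f≤1 f≡0 = z≤n
  sumOver≤C zero    (s ∷ S)       f≤1 f≡0 = ≤-trans
    (sumOver≤C zero S (f≤1 ∘ (_ ∷_)) λ A A⊈S → f≡0 (_ ∷ A) λ sub → A⊈S (drop-∷-⊆ sub))
    (≤-reflexive (trans (nC0≡1 ∣ S ∣) (sym (nC0≡1 ∣ s ∷ S ∣))))
  sumOver≤C {suc n} (suc k) (outside ∷ S) {f} f≤1 f≡0 = begin
    sumOver (suc k) (f ∘ (outside ∷_)) + sumOver k (f ∘ (inside ∷_))
      ≤⟨ +-mono-≤
        (sumOver≤C (suc k) S (f≤1 ∘ (_ ∷_)) λ A A⊈S → f≡0 (_ ∷ A) λ sub → A⊈S (drop-∷-⊆ sub))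
        (sumOver-mono k {g = λ _ → 0} λ A _ → ≤-reflexive (f≡0 (inside ∷ A) λ sub → contradiction (sub here) λ ())) ⟩
    ∣ S ∣ C suc k + sumOver {n} k (λ _ → 0)
      ≡⟨ cong (∣ S ∣ C suc k +_) (trans (sumOver-const n k 0) (*-zeroʳ (n C k))) ⟩
    ∣ S ∣ C suc k + 0   ≡⟨ +-identityʳ _ ⟩
    ∣ S ∣ C suc k       ∎
    where open ≤-Reasoning
  sumOver≤C (suc k) (inside ∷ S) {f} f≤1 f≡0 = begin
    sumOver (suc k) (f ∘ (outside ∷_)) + sumOver k (f ∘ (inside ∷_))
      ≤⟨ +-mono-≤
        (sumOver≤C (suc k) S (f≤1 ∘ (_ ∷_)) λ A A⊈S → f≡0 (_ ∷ A) λ sub → A⊈S (drop-∷-⊆ sub))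
        (sumOver≤C k S (f≤1 ∘ (_ ∷_)) λ A A⊈S → f≡0 (_ ∷ A) λ sub → A⊈S (drop-∷-⊆ sub)) ⟩
    ∣ S ∣ C suc k + ∣ S ∣ C k   ≡⟨ +-comm (∣ S ∣ C suc k) _ ⟩
    ∣ S ∣ C k + ∣ S ∣ C suc k   ≡⟨ nCk+nC[k+1]≡[n+1]C[k+1] ∣ S ∣ k ⟩
    suc ∣ S ∣ C suc k           ∎
    where open ≤-Reasoning

  -- Double counting for a family of blocks.

  module DoubleCounting {n m} (F : Fin m → Subset n) where

    containing : Subset n → Subset m
    containing A = subset λ j → A ⊆? F j

    blocks : Fin n → Subset m
    blocks v = subset λ j → v ∈? F j

    common : Subset m → Subset n
    common T = subset λ v → T ⊆? blocks v

    ∈-containing⁻ : ∀ {A j} → j ∈ containing A → A ⊆ F j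
    ∈-containing⁻ {A} = ∈-subset⁻ {P = λ j → A ⊆ F j} (λ j → A ⊆? F j)

    ∈-containing⁺ : ∀ {A j} → A ⊆ F j → j ∈ containing A
    ∈-containing⁺ {A} = ∈-subset⁺ {P = λ j → A ⊆ F j} (λ j → A ⊆? F j)

    ∈-common⁻ : ∀ {T v j} → v ∈ common T → j ∈ T → v ∈ F j
    ∈-common⁻ {T} {v} v∈ j∈T = ∈-subset⁻ {P = λ j → v ∈ F j} (λ j → v ∈? F j)
      (∈-subset⁻ {P = λ v → T ⊆ blocks v} (λ v → T ⊆? blocks v) v∈ j∈T)

    ⊆-common⁺ : ∀ {A T} → T ⊆ containing A → A ⊆ common T
    ⊆-common⁺ {A} {T} T⊆ {v} v∈A = ∈-subset⁺ {P = λ v → T ⊆ blocks v} (λ v → T ⊆? blocks v) λ j∈T →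
      ∈-subset⁺ {P = λ j → v ∈ F j} (λ j → v ∈? F j) (∈-containing⁻ (T⊆ j∈T) v∈A)

    -- The sets counted have `suc k` elements, so `k < q` makes `q C suc k` positive, hence
    -- cancellable. `rich` may stay doubly negated because it only feeds comparisons of natural
    -- numbers.
    module _ {k q} (k<q : k < q)
      (rich : ∀ A → ∣ A ∣ ≡ suc k → ¬ ¬ ∃ λ B → q ≤ ∣ B ∣ × B ⊆ containing A ×
        (∀ T → T ⊆ B → ∣ T ∣ ≡ suc k → ∣ common T ∣ ≤ q))
      where

      Counted : Subset n → Subset m → Set
      Counted A T = A ⊆ common T × ∣ common T ∣ ≤ q

      counted? : ∀ A T → Dec (Counted A T)
      counted? A T = (A ⊆? common T) ×-dec (∣ common T ∣ ≤? q)

      weight : Subset n → Subset m → ℕ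
      weight A T with counted? A T
      ... | yes _ = 1
      ... | no  _ = 0

      1≤weight : ∀ {A T} → Counted A T → 1 ≤ weight A T
      1≤weight {A} {T} p with counted? A T
      ... | yes _ = ≤-refl
      ... | no ¬p = contradiction p ¬p

      weight≤1 : ∀ A T → weight A T ≤ 1
      weight≤1 A T with counted? A T
      ... | yes _ = ≤-refl
      ... | no  _ = z≤n

      weight≡0 : ∀ {A T} → ¬ Counted A T → weight A T ≡ 0
      weight≡0 {A} {T} ¬p with counted? A T
      ... | yes p = contradiction p ¬p
      ... | no  _ = refl

      row≥ : ∀ A → ∣ A ∣ ≡ suc k → q C suc k ≤ sumOver (suc k) (weight A)
      row≥ A eq = decidable-stable (_ ≤? _) λ ¬le → rich A eq λ (B , q≤B , B⊆ , small) →
        ¬le (≤-trans (C-mono (suc k) q≤B) (C≤sumOver (suc k) B λ T T⊆B eqT →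
          1≤weight (⊆-common⁺ (B⊆ ∘ T⊆B) , small T T⊆B eqT)))

      column-zero : ∀ T → ¬ ∣ common T ∣ ≤ q → sumOver (suc k) (λ A → weight A T) ≤ 0
      column-zero T big = begin
        sumOver (suc k) (λ A → weight A T)  ≤⟨ sumOver-mono (suc k) {g = λ _ → 0} (λ A _ → ≤-reflexive (weight≡0 {A} {T} (big ∘ proj₂))) ⟩
        sumOver {n} (suc k) (λ _ → 0)       ≡⟨ sumOver-const n (suc k) 0 ⟩
        (n C suc k) * 0                     ≡⟨ *-zeroʳ (n C suc k) ⟩
        0                                   ∎
        where open ≤-Reasoning

      column≤ : ∀ T → sumOver (suc k) (λ A → weight A T) ≤ q C suc k
      column≤ T = by-size (∣ common T ∣ ≤? q)
        where
        by-size : Dec (∣ common T ∣ ≤ q) → sumOver (suc k) (λ A → weight A T) ≤ q C suc k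
        by-size (yes small) = ≤-trans
          (sumOver≤C (suc k) (common T) (λ A → weight≤1 A T) (λ A A⊈ → weight≡0 (λ p → A⊈ (λ {x} → proj₁ p {x}))))
          (C-mono (suc k) small)
        by-size (no big) = ≤-trans (column-zero T big) z≤n

      total : ℕ
      total = sumOver (suc k) (λ A → sumOver (suc k) (weight A))

      total≥ : (n C suc k) * (q C suc k) ≤ total
      total≥ = subst (_≤ total) (sumOver-const n (suc k) (q C suc k)) (sumOver-mono (suc k) row≥)

      total≤ : total ≤ (m C suc k) * (q C suc k)
      total≤ = begin
        total
          ≡⟨ sumOver-swap (suc k) (suc k) weight ⟩
        sumOver (suc k) (λ T → sumOver (suc k) (λ A → weight A T))
          ≤⟨ sumOver-mono (suc k) (λ T _ → column≤ T) ⟩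
        sumOver {m} (suc k) (λ _ → q C suc k)
          ≡⟨ sumOver-const m (suc k) (q C suc k) ⟩
        (m C suc k) * (q C suc k)
          ∎
        where open ≤-Reasoning

      points≤blocks : suc k ≤ n → n ≤ m
      points≤blocks k<n = C-cancel-≤ k<n
        (*-cancelʳ-≤ (n C suc k) (m C suc k) (q C suc k) {{>-nonZero (C-pos k<q)}} (≤-trans total≥ total≤))

      module _ (m≤n : m ≤ n) where

        mC≤nC : (m C suc k) * (q C suc k) ≤ (n C suc k) * (q C suc k)
        mC≤nC = *-monoˡ-≤ (q C suc k) (C-mono (suc k) m≤n)

        -- With `m ≤ n` the double count closes into a circle of inequalities, so each column and
        -- each row attains its bound.
        column≥ : ∀ T → ∣ T ∣ ≡ suc k → q C suc k ≤ sumOver (suc k) (λ A → weight A T)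
        column≥ = sumOver-tight (suc k) (λ T _ → column≤ T) (begin
          sumOver {m} (suc k) (λ _ → q C suc k)  ≡⟨ sumOver-const m (suc k) (q C suc k) ⟩
          (m C suc k) * (q C suc k)              ≤⟨ mC≤nC ⟩
          (n C suc k) * (q C suc k)              ≤⟨ total≥ ⟩
          total                                  ≡⟨ sumOver-swap (suc k) (suc k) weight ⟩
          sumOver (suc k) (λ T → sumOver (suc k) (λ A → weight A T)) ∎)
          where open ≤-Reasoning

        row≤ : ∀ A → ∣ A ∣ ≡ suc k → sumOver (suc k) (weight A) ≤ q C suc k
        row≤ = sumOver-tight (suc k) row≥ (begin
          total                                  ≤⟨ total≤ ⟩
          (m C suc k) * (q C suc k)              ≤⟨ mC≤nC ⟩
          (n C suc k) * (q C suc k)              ≡⟨ sumOver-const n (suc k) (q C suc k) ⟨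
          sumOver {n} (suc k) (λ _ → q C suc k)  ∎)
          where open ≤-Reasoning

        -- A large `T` has an empty column, against the positive lower bound in `column≥`.
        common-small : ∀ T → ∣ T ∣ ≡ suc k → ∣ common T ∣ ≤ q
        common-small T eq = decidable-stable (∣ common T ∣ ≤? q) λ big →
          contradiction (≤-trans (column≥ T eq) (column-zero T big)) (<⇒≱ (C-pos k<q))

        -- Since all sets of `suc k` blocks are now small, each one taken from `containing A` counts
        -- in the row of `A`, and that row has room for the subsets of only `q` blocks.
        containing-small : ∀ A → ∣ A ∣ ≡ suc k → ∣ containing A ∣ ≤ q
        containing-small A eq with suc k ≤? ∣ containing A ∣
        ... | no  few  = ≤-trans (<⇒≤ (≰⇒> few)) k<q
        ... | yes many = C-cancel-≤ many (≤-trans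
          (C≤sumOver (suc k) (containing A) λ T T⊆ eqT → 1≤weight (⊆-common⁺ T⊆ , common-small T eqT))
          (row≤ A eq))

-- The double-negation monad.

module DoubleNegation where

  open import Data.Fin using (Fin; zero; suc)
  open import Data.Nat using (zero; suc)
  open import Relation.Nullary using (¬_)

  infixl 1 _>>=_
  _>>=_ : ∀ {a b} {A : Set a} {B : Set b} → ¬ ¬ A → (A → ¬ ¬ B) → ¬ ¬ B
  (m >>= f) ¬b = m λ a → f a ¬b

  pure : ∀ {a} {A : Set a} → A → ¬ ¬ A
  pure a ¬a = ¬a a

  ¬¬-∀ : ∀ {a n} {P : Fin n → Set a} → (∀ i → ¬ ¬ P i) → ¬ ¬ (∀ i → P i)
  ¬¬-∀ {n = zero}  ¬¬P = pure λ ()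
  ¬¬-∀ {n = suc n} ¬¬P = do
    p₀ ← ¬¬P zero
    ps ← ¬¬-∀ (λ i → ¬¬P (suc i))
    pure λ where
      zero    → p₀
      (suc i) → ps i

-- Linear algebra over an ordered field without decidable equality.

module LinearAlgebra {c ℓ₁ ℓ₂} (K : OrderedField c ℓ₁ ℓ₂) where

  open import Data.Empty using (⊥-elim)
  open import Data.Fin using (Fin; zero; suc; punchIn; punchOut)
  import Data.Fin.Properties as Fin
  open import Data.Fin.Subset using (Subset; _∈_; _∉_; ∣_∣; ⊤; inside; outside)
  open import Data.Fin.Subset.Properties using (_∈?_; ∣⊤∣≡n; drop-there)
  open import Data.Nat as ℕ using (ℕ; zero; suc)
  import Data.Nat.Properties as ℕ
  open import Data.Product using (∃; _×_; _,_)
  open import Data.Sum using (inj₁; inj₂)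
  open import Data.Vec using ([]; _∷_; here; there)
  open import Data.Vec.Functional using () renaming (_∷_ to _◂_)
  open import Function using (_∘_; id)
  open import Relation.Binary.PropositionalEquality as ≡ using (_≡_; _≢_)
  open import Relation.Binary.Structures using (IsTotalOrder)
  open import Relation.Nullary using (¬_; Dec; yes; no; contradiction)
  open import Relation.Nullary.Decidable using (¬¬-excluded-middle)

  open DoubleNegation

  open OrderedField K hiding (zero) renaming (_≤_ to infix 4 _≤_)
  open IsTotalOrder isTotalOrder using (total; antisym; ≤-respˡ-≈; ≤-respʳ-≈)
    renaming (refl to ≤-refl; trans to ≤-trans; reflexive to ≤-reflexive)
  open import Algebra.Properties.Ring ring
  open import Algebra.Properties.Semiring.Sum semiring
  open import Algebra.Properties.CommutativeSemigroup *-commutativeSemigroup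
    using (x∙yz≈y∙xz; x∙yz≈z∙yx; x∙yz≈y∙zx)
  open import Relation.Binary.Reasoning.Setoid setoid

  private
    variable
      n m p : ℕ

  0≤-x : ∀ {x} → x ≤ 0# → 0# ≤ - x
  0≤-x {x} x≤0 = ≤-respˡ-≈ (-‿inverseʳ x) (≤-respʳ-≈ (+-identityˡ _) (+-mono-≤ (- x) x≤0))

  +-nonneg : ∀ {x y} → 0# ≤ x → 0# ≤ y → 0# ≤ x + y
  +-nonneg {x} {y} 0≤x 0≤y = ≤-trans 0≤y (≤-respˡ-≈ (+-identityˡ y) (+-mono-≤ y 0≤x))

  x≤x+y : ∀ {x y} → 0# ≤ y → x ≤ x + y
  x≤x+y {x} {y} 0≤y = ≤-respˡ-≈ (+-identityˡ x) (≤-respʳ-≈ (+-comm y x) (+-mono-≤ x 0≤y))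

  0≤y-x : ∀ {x y} → x ≤ y → 0# ≤ y - x
  0≤y-x {x} {y} x≤y = ≤-respˡ-≈ (-‿inverseʳ x) (+-mono-≤ (- x) x≤y)

  0≤y-x⇒x≤y : ∀ {x y} → 0# ≤ y - x → x ≤ y
  0≤y-x⇒x≤y {x} {y} le = ≤-respˡ-≈ (+-identityˡ x) (≤-respʳ-≈ eq (+-mono-≤ x le))
    where
    eq : y - x + x ≈ y
    eq = trans (+-assoc y (- x) x) (trans (+-congˡ (-‿inverseˡ x)) (+-identityʳ y))

  *-monoʳ-≤ : ∀ {a x y} → 0# ≤ a → x ≤ y → a * x ≤ a * y
  *-monoʳ-≤ {a} {x} {y} 0≤a x≤y = 0≤y-x⇒x≤y (≤-respʳ-≈ (x[y-z]≈xy-xz a y x) (*-nonneg 0≤a (0≤y-x x≤y)))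

  *-cancel-≈0 : ∀ {a x} → ¬ a ≈ 0# → a * x ≈ 0# → x ≈ 0#
  *-cancel-≈0 {a} {x} a≉0 ax≈0 with b , ab≈1 ← inverse a a≉0 = begin
    x              ≈⟨ *-identityˡ x ⟨
    1# * x         ≈⟨ *-congʳ (trans (*-comm b a) ab≈1) ⟨
    (b * a) * x    ≈⟨ *-assoc b a x ⟩
    b * (a * x)    ≈⟨ *-congˡ ax≈0 ⟩
    b * 0#         ≈⟨ zeroʳ b ⟩
    0#             ∎

  -- If `y ≤ x`, the two products agree by antisymmetry and cancellation gives `x ≈ y`; totality
  -- thus replaces a case split on the strict order.
  *-cancel-≤ : ∀ {a x y} → 0# ≤ a → ¬ a ≈ 0# → a * x ≤ a * y → x ≤ y
  *-cancel-≤ {a} {x} {y} 0≤a a≉0 ax≤ay with total x y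
  ... | inj₁ x≤y = x≤y
  ... | inj₂ y≤x = ≤-reflexive (x∙y⁻¹≈ε⇒x≈y x y (*-cancel-≈0 a≉0 (begin
    a * (x - y)      ≈⟨ x[y-z]≈xy-xz a x y ⟩
    a * x - a * y    ≈⟨ +-congʳ (antisym ax≤ay (*-monoʳ-≤ 0≤a y≤x)) ⟩
    a * y - a * y    ≈⟨ -‿inverseʳ (a * y) ⟩
    0#               ∎)))

  sum-zero : {f : Fin n → Carrier} → (∀ i → f i ≈ 0#) → sum f ≈ 0#
  sum-zero {n} f≈0 = trans (sum-cong-≋ f≈0) (sum-replicate-zero n)

  sum-nonneg : {f : Fin n → Carrier} → (∀ i → 0# ≤ f i) → 0# ≤ sum f
  sum-nonneg {zero}  0≤f = ≤-refl
  sum-nonneg {suc n} 0≤f = +-nonneg (0≤f zero) (sum-nonneg (0≤f ∘ suc))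

  nonneg-sum-zero : {f : Fin n → Carrier} → (∀ i → 0# ≤ f i) → sum f ≈ 0# → ∀ i → f i ≈ 0#
  nonneg-sum-zero {suc n} {f} 0≤f ∑≈0 = λ where
      zero    → f₀≈0
      (suc i) → nonneg-sum-zero (0≤f ∘ suc) (trans (sym (trans (+-congʳ f₀≈0) (+-identityˡ _))) ∑≈0) i
    where
    f₀≈0 : f zero ≈ 0#
    f₀≈0 = antisym (≤-respʳ-≈ ∑≈0 (x≤x+y (sum-nonneg (0≤f ∘ suc)))) (0≤f zero)

  infixl 7 _•_
  _•_ : (Fin n → Carrier) → (Fin n → Carrier) → Carrier
  h • x = sum λ j → h j * x j

  comb : Carrier → (Fin n → Carrier) → Carrier → (Fin n → Carrier) → Fin n → Carrier
  comb a f b g j = a * f j + b * g j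

  •-comm : ∀ (f x : Fin n → Carrier) → f • x ≈ x • f
  •-comm f x = sum-cong-≋ λ j → *-comm (f j) (x j)

  comb-• : ∀ a (f : Fin n → Carrier) b g x → comb a f b g • x ≈ a * (f • x) + b * (g • x)
  comb-• a f b g x = begin
    sum (λ j → comb a f b g j * x j)
      ≈⟨ sum-cong-≋ (λ j → trans (distribʳ (x j) _ _) (+-cong (*-assoc a _ _) (*-assoc b _ _))) ⟩
    sum (λ j → a * (f j * x j) + b * (g j * x j))
      ≈⟨ ∑-distrib-+ (λ j → a * (f j * x j)) (λ j → b * (g j * x j)) ⟩
    sum (λ j → a * (f j * x j)) + sum (λ j → b * (g j * x j))
      ≈⟨ +-cong (*-distribˡ-sum a (λ j → f j * x j)) (*-distribˡ-sum b (λ j → g j * x j)) ⟨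
    a * (f • x) + b * (g • x)
      ∎

  •-comb : ∀ h a (x : Fin n → Carrier) b y → h • comb a x b y ≈ a * (h • x) + b * (h • y)
  •-comb h a x b y = trans (•-comm h _) (trans (comb-• a x b y h)
    (+-cong (*-congˡ (•-comm x h)) (*-congˡ (•-comm y h))))

  Dependency : (Fin n → Fin p → Carrier) → (Fin n → Carrier) → Set ℓ₁
  Dependency X c = ∀ j → sum (λ i → c i * X i j) ≈ 0#

  Independent : (Fin n → Fin p → Carrier) → Set _
  Independent X = ∀ c → Dependency X c → ∀ i → c i ≈ 0#

  DependentOn : (Fin n → Fin p → Carrier) → Subset n → Set _
  DependentOn X Q = ∃ λ c → (∀ i → i ∉ Q → c i ≈ 0#) × (∃ λ i → ¬ c i ≈ 0#) × Dependency X c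

  dependency-• : ∀ (X : Fin n → Fin p → Carrier) c → Dependency X c → ∀ h →
    sum (λ i → c i * (h • X i)) ≈ 0#
  dependency-• X c dep h = begin
    sum (λ i → c i * (h • X i))
      ≈⟨ sum-cong-≋ (λ i → trans (*-distribˡ-sum (c i) (λ j → h j * X i j))
                               (sum-cong-≋ (λ j → x∙yz≈y∙xz (c i) (h j) (X i j)))) ⟩
    sum (λ i → sum (λ j → h j * (c i * X i j)))
      ≈⟨ ∑-comm (λ i j → h j * (c i * X i j)) ⟩
    sum (λ j → sum (λ i → h j * (c i * X i j)))
      ≈⟨ sum-zero (λ j → trans (sym (*-distribˡ-sum (h j) (λ i → c i * X i j))) (trans (*-congˡ (dep j)) (zeroʳ _))) ⟩
    0# ∎

  module _ (X : Fin (suc n) → Fin (suc p) → Carrier) (r : Fin (suc p)) (b : Carrier)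
           (ab≈1 : X zero r * b ≈ 1#) where

    -- Gaussian elimination with pivot `X zero r`: a multiple of `X zero` clears coordinate `r`,
    -- which is then deleted.
    eliminate : Fin n → Fin p → Carrier
    eliminate i s = X (suc i) (punchIn r s) + X (suc i) r * - (b * X zero (punchIn r s))

    -- Coordinate `r` forces the coefficient of `X zero`.
    backSubstitute : (Fin n → Carrier) → Fin (suc n) → Carrier
    backSubstitute c = - (b * sum (λ i → c i * X (suc i) r)) ◂ c

    backSubstitute-dependency : ∀ c → Dependency eliminate c → Dependency X (backSubstitute c)
    backSubstitute-dependency c dep j with r Fin.≟ j
    ... | yes ≡.refl = begin
      - (b * σ) * X zero r + σ   ≈⟨ +-congʳ (-‿distribˡ-* (b * σ) (X zero r)) ⟨
      - (b * σ * X zero r) + σ   ≈⟨ +-congʳ (-‿cong (trans (*-comm _ _) (sym (*-assoc _ _ _)))) ⟩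
      - (X zero r * b * σ) + σ   ≈⟨ +-congʳ (-‿cong (trans (*-congʳ ab≈1) (*-identityˡ σ))) ⟩
      - σ + σ                    ≈⟨ -‿inverseˡ σ ⟩
      0#                         ∎
      where
      σ : Carrier
      σ = sum (λ i → c i * X (suc i) r)
    ... | no r≢j = ≡.subst (λ j → sum (λ i → backSubstitute c i * X i j) ≈ 0#) (Fin.punchIn-punchOut r≢j) (begin
      - (b * σ) * x + sum (λ i → c i * X (suc i) (punchIn r s))
        ≈⟨ +-comm _ _ ⟩
      sum (λ i → c i * X (suc i) (punchIn r s)) + - (b * σ) * x
        ≈⟨ +-congˡ (begin
          - (b * σ) * x      ≈⟨ -‿distribˡ-* (b * σ) x ⟨
          - (b * σ * x)      ≈⟨ -‿cong (trans (*-congʳ (*-comm b σ)) (*-assoc σ b x)) ⟩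
          - (σ * (b * x))    ≈⟨ -‿distribʳ-* σ (b * x) ⟩
          σ * - (b * x)      ∎) ⟩
      sum (λ i → c i * X (suc i) (punchIn r s)) + σ * - (b * x)
        ≈⟨ +-congˡ (*-distribʳ-sum (- (b * x)) (λ i → c i * X (suc i) r)) ⟩
      sum (λ i → c i * X (suc i) (punchIn r s)) + sum (λ i → c i * X (suc i) r * - (b * x))
        ≈⟨ ∑-distrib-+ (λ i → c i * X (suc i) (punchIn r s)) (λ i → c i * X (suc i) r * - (b * x)) ⟨
      sum (λ i → c i * X (suc i) (punchIn r s) + c i * X (suc i) r * - (b * x))
        ≈⟨ sum-cong-≋ (λ (i : Fin n) → trans (+-congˡ (*-assoc _ _ _)) (sym (distribˡ _ _ _))) ⟩
      sum (λ i → c i * eliminate i s)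
        ≈⟨ dep s ⟩
      0# ∎)
      where
      s : Fin p
      s = punchOut r≢j
      x σ : Carrier
      x = X zero (punchIn r s)
      σ = sum (λ i → c i * X (suc i) r)

  dependent : ∀ (X : Fin n → Fin p → Carrier) Q → p ℕ.< ∣ Q ∣ → ¬ ¬ DependentOn X Q
  dependent X (outside ∷ Q) p<Q = do
    c , supp , (i , cᵢ≉0) , dep ← dependent (X ∘ suc) Q p<Q
    pure (0# ◂ c , (λ where zero _ → refl
                            (suc i) i∉ → supp i (i∉ ∘ there)) ,
      (suc i , cᵢ≉0) , λ j → trans (+-cong (zeroˡ _) (dep j)) (+-identityˡ 0#))
  dependent {p = p} X (inside ∷ Q) p<Q = do
    yes (r , nz) ← ¬¬-excluded-middle {A = ∃ λ r → ¬ X zero r ≈ 0#}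
      where
      -- Without a pivot the vector itself is zero, so coefficient 1 on it alone is a dependency.
      no none → do
        X₀≈0 ← ¬¬-∀ (λ r nz → none (r , nz))
        pure (1# ◂ (λ _ → 0#) ,
          (λ where zero i∉ → ⊥-elim (i∉ here)
                   (suc i) _ → refl) ,
          (zero , λ 1≈0 → 0≉1 (sym 1≈0)) ,
          λ j → trans (+-cong (trans (*-identityˡ _) (X₀≈0 j)) (sum-zero {f = λ i → 0# * X (suc i) j} (λ i → zeroˡ _))) (+-identityˡ 0#))
    pivot {X = X} r nz p<Q
    where
    pivot : ∀ {p} {X : Fin (suc _) → Fin p → Carrier} r → ¬ X zero r ≈ 0# → p ℕ.< suc ∣ Q ∣ →
      ¬ ¬ DependentOn X (inside ∷ Q)
    pivot {suc p} {X} r nz (ℕ.s≤s p<Q) = do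
      let b , ab≈1 = inverse (X zero r) nz
      c , supp , (i , cᵢ≉0) , dep ← dependent (eliminate X r b ab≈1) Q p<Q
      pure (backSubstitute X r b ab≈1 c ,
        (λ where zero i∉ → ⊥-elim (i∉ here)
                 (suc i) i∉ → supp i (i∉ ∘ there)) ,
        (suc i , cᵢ≉0) , backSubstitute-dependency X r b ab≈1 c dep)

  -- Transposition: a dependency among the `p` coordinate columns is a functional that vanishes on
  -- every `X i`.
  common-zero : ∀ {r} (X : Fin r → Fin p → Carrier) → r ℕ.< p →
    ¬ ¬ ∃ λ g → (∃ λ j → ¬ g j ≈ 0#) × ∀ i → g • X i ≈ 0#
  common-zero {p} X r<p = do
    g , _ , nz , dep ← dependent (λ j i → X i j) ⊤ (≡.subst (_ ℕ.<_) (≡.sym (∣⊤∣≡n p)) r<p)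
    pure (g , nz , dep)

  independent-◂ : ∀ {X : Fin n → Fin p → Carrier} {z} h → Independent X →
    (∀ i → h • X i ≈ 0#) → ¬ h • z ≈ 0# → Independent (z ◂ X)
  independent-◂ {X = X} {z} h ind hX≈0 hz≉0 c dep = λ where
      zero    → c₀≈0
      (suc i) → ind (c ∘ suc) (λ j → trans (sym (trans (+-congʳ (trans (*-congʳ c₀≈0) (zeroˡ _))) (+-identityˡ _))) (dep j)) i
    where
    c₀≈0 : c zero ≈ 0#
    c₀≈0 = *-cancel-≈0 hz≉0 (begin
      (h • z) * c zero                                                 ≈⟨ *-comm _ _ ⟩
      c zero * (h • z)                                                 ≈⟨ +-identityʳ _ ⟨
      c zero * (h • z) + 0#                                            ≈⟨ +-congˡ (sum-zero λ i → trans (*-congˡ (hX≈0 i)) (zeroʳ _)) ⟨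
      c zero * (h • z) + sum (λ i → c (suc i) * (h • X i))             ≈⟨ dependency-• (z ◂ X) c dep h ⟩
      0#                                                               ∎)

  zero-on-basis : ∀ {b : Fin p → Fin p → Carrier} g → Independent b → (∀ i → g • b i ≈ 0#) →
    ∀ y → ¬ ¬ g • y ≈ 0#
  zero-on-basis {p} {b} g ind gb≈0 y gy≉0 =
    dependent (y ◂ b) ⊤ (≡.subst (p ℕ.<_) (≡.sym (∣⊤∣≡n (suc p))) ℕ.≤-refl) λ (c , _ , (i , cᵢ≉0) , dep) →
    cᵢ≉0 (independent-◂ g ind gb≈0 gy≉0 c dep i)

  -- The dual vectors certify that the common kernel of the `ℓ i` has codimension `t`. Adjoined to
  -- `Q` they give more than `p` vectors, and in the resulting dependency `ℓ i` isolates the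
  -- coefficient of `y i` and shows that it is zero.
  dependent-in-kernel : ∀ {t} (X : Fin n → Fin p → Carrier) Q (ℓ y : Fin t → Fin p → Carrier) →
    (∀ i → ℓ i • y i ≈ 1#) → (∀ {i j} → i ≢ j → ℓ i • y j ≈ 0#) →
    (∀ i {v} → v ∈ Q → ℓ i • X v ≈ 0#) → p ℕ.< t ℕ.+ ∣ Q ∣ → ¬ ¬ DependentOn X Q
  dependent-in-kernel {t = zero}  X Q ℓ y diag off kills p<Q = dependent X Q p<Q
  dependent-in-kernel {p = p} {t = suc t} X Q ℓ y diag off kills p<tQ = do
    c , supp , nz , dep ← dependent-in-kernel (y zero ◂ X) (inside ∷ Q) (ℓ ∘ suc) (y ∘ suc) (diag ∘ suc)
      (λ i≢j → off (i≢j ∘ Fin.suc-injective))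
      (λ where i here       → off λ ()
               i (there v∈) → kills (suc i) v∈)
      (≡.subst (p ℕ.<_) (≡.sym (ℕ.+-suc t _)) p<tQ)
    let
      term≈0 : ∀ i → c (suc i) * (ℓ zero • X i) ≈ 0#
      term≈0 i = case-∈ (i ∈? Q) (λ i∈ → trans (*-congˡ (kills zero i∈)) (zeroʳ _))
                                 (λ i∉ → trans (*-congʳ (supp (suc i) (i∉ ∘ drop-there))) (zeroˡ _))
      c₀≈0 : c zero ≈ 0#
      c₀≈0 = trans (sym (trans (+-cong (trans (*-congˡ (diag zero)) (*-identityʳ _)) (sum-zero term≈0)) (+-identityʳ _)))
        (dependency-• (y zero ◂ X) c dep (ℓ zero))
    pure (c ∘ suc , (λ i i∉ → supp (suc i) (i∉ ∘ drop-there)) , nonzero c c₀≈0 nz ,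
      λ j → trans (sym (trans (+-congʳ (trans (*-congʳ c₀≈0) (zeroˡ _))) (+-identityˡ _))) (dep j))
    where
    case-∈ : ∀ {a b} {A : Set a} {B : Set b} → Dec A → (A → B) → (¬ A → B) → B
    case-∈ (yes x) f g = f x
    case-∈ (no ¬x) f g = g ¬x
    nonzero : ∀ {n} (c : Fin (suc n) → Carrier) → c zero ≈ 0# → (∃ λ i → ¬ c i ≈ 0#) → ∃ λ i → ¬ c (suc i) ≈ 0#
    nonzero c c₀≈0 (zero  , c₀≉0) = contradiction c₀≈0 c₀≉0
    nonzero c c₀≈0 (suc i , cᵢ≉0) = i , cᵢ≉0

  -- The ratio e / h is maximal at q; cross-multiplied, since h may vanish.
  max-ratio : ∀ (h e : Fin n → Carrier) → (∀ j → 0# ≤ h j) → (∀ j → Dec (h j ≈ 0#)) →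
    (∀ j → h j ≈ 0# → e j ≈ 0#) → ∀ p → 0# ≤ e p → ¬ e p ≈ 0# →
    ∃ λ q → ¬ h q ≈ 0# × ¬ e q ≈ 0# × ∀ j → h q * e j ≤ e q * h j
  max-ratio {n} h e 0≤h h≟0 h⇒e p 0≤eₚ eₚ≉0 with best id
    where
    best : ∀ {l} (f : Fin l → Fin n) → ∃ λ q → ¬ h q ≈ 0# × ∀ i → h q * e (f i) ≤ e q * h (f i)
    best {zero}  f = p , (λ hₚ≈0 → eₚ≉0 (h⇒e p hₚ≈0)) , λ ()
    best {suc l} f with best (f ∘ suc) | h≟0 (f zero)
    ... | q , hq≉0 , max | yes h₀≈0 = q , hq≉0 , λ where
      zero    → ≤-reflexive (trans (trans (*-congˡ (h⇒e _ h₀≈0)) (zeroʳ _)) (sym (trans (*-congˡ h₀≈0) (zeroʳ _))))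
      (suc i) → max i
    ... | q , hq≉0 , max | no h₀≉0 with total (h q * e (f zero)) (e q * h (f zero))
    ...   | inj₁ le = q , hq≉0 , λ where
      zero    → le
      (suc i) → max i
    ...   | inj₂ ge = f zero , h₀≉0 , λ where
      zero    → ≤-reflexive (*-comm _ _)
      (suc i) → *-cancel-≤ (0≤h q) hq≉0 (≤-trans
        (≤-respˡ-≈ (x∙yz≈y∙xz _ _ _) (*-monoʳ-≤ (0≤h (f zero)) (max i)))
        (≤-respˡ-≈ (x∙yz≈z∙yx _ _ _) (≤-respʳ-≈ (x∙yz≈y∙zx _ _ _) (*-monoʳ-≤ (0≤h (f (suc i))) ge))))
  ... | q , hq≉0 , max = q , hq≉0 , eq≉0 , max
    where
    eq≉0 : ¬ e q ≈ 0#
    eq≉0 eq≈0 = eₚ≉0 (*-cancel-≈0 hq≉0 (antisym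
      (≤-respʳ-≈ (trans (*-congʳ eq≈0) (zeroˡ _)) (max p)) (*-nonneg (0≤h q) 0≤eₚ)))

-- Neighborly polytopes in homogeneous coordinates.

module Geometry {c ℓ₁ ℓ₂} (K : OrderedField c ℓ₁ ℓ₂) where

  open import Data.Fin using (Fin; zero; suc; punchIn)
  import Data.Fin.Properties as Fin
  open import Data.Fin.Subset using (Subset; _∈_; _∉_; _⊆_; ∣_∣; ⊥; ⊤; ∁; ⁅_⁆; _∩_)
  open import Data.Fin.Subset.Properties
  open import Data.Nat as ℕ using (ℕ; zero; suc)
  import Data.Nat.Properties as ℕ
  open import Data.Product using (∃; _×_; _,_; proj₁; proj₂)
  open import Data.Sum using (_⊎_; inj₁; inj₂)
  open import Data.Vec.Functional using () renaming (_∷_ to _◂_)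
  open import Function using (_∘_; id)
  open import Function.Bundles using (_⇔_; mk⇔; Equivalence)
  open import Function.Definitions using (Injective)
  open import Relation.Binary.PropositionalEquality as ≡ using (_≡_; _≢_)
  open import Relation.Binary.Structures using (IsTotalOrder)
  open import Level using (_⊔_)
  open import Relation.Nullary using (¬_; Dec; yes; no; contradiction)
  open import Relation.Nullary.Decidable using (¬¬-excluded-middle; decidable-stable)

  open DoubleNegation
  open FiniteSets
  open LinearAlgebra K
  open Equivalence using (to; from)

  open OrderedField K hiding (zero) renaming (_≤_ to infix 4 _≤_)
  open IsTotalOrder isTotalOrder using (total; ≤-respʳ-≈) renaming (reflexive to ≤-reflexive)
  open import Algebra.Properties.Ring ring
  open import Algebra.Properties.Semiring.Sum semiring
  open import Relation.Binary.Reasoning.Setoid setoid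

  x*x-nonneg : ∀ x → 0# ≤ x * x
  x*x-nonneg x with total 0# x
  ... | inj₁ 0≤x = *-nonneg 0≤x 0≤x
  ... | inj₂ x≤0 = ≤-respʳ-≈
    (trans (sym (-‿distribˡ-* x (- x))) (trans (-‿cong (sym (-‿distribʳ-* x x))) (-‿involutive _)))
    (*-nonneg (0≤-x x≤0) (0≤-x x≤0))

  x≈0⇒-x≈0 : ∀ {x} → x ≈ 0# → - x ≈ 0#
  x≈0⇒-x≈0 x≈0 = trans (-‿cong x≈0) -0#≈0#

  -x≈0⇒x≈0 : ∀ {x} → - x ≈ 0# → x ≈ 0#
  -x≈0⇒x≈0 -x≈0 = trans (sym (-‿involutive _)) (x≈0⇒-x≈0 -x≈0)

  -x≉0 : ∀ {x} → ¬ x ≈ 0# → ¬ - x ≈ 0#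
  -x≉0 x≉0 -x≈0 = x≉0 (-x≈0⇒x≈0 -x≈0)

  *-nonzero : ∀ {x y} → ¬ x ≈ 0# → ¬ y ≈ 0# → ¬ x * y ≈ 0#
  *-nonzero x≉0 y≉0 xy≈0 = y≉0 (*-cancel-≈0 x≉0 xy≈0)

  negate : ∀ {n} → (Fin n → Carrier) → Fin n → Carrier
  negate f i = - f i

  negate-• : ∀ {n} (f x : Fin n → Carrier) → negate f • x ≈ - (f • x)
  negate-• {n} f x = begin
    sum (λ i → - f i * x i)          ≈⟨ sum-cong-≋ (λ (i : Fin n) → trans (sym (-‿distribˡ-* (f i) (x i))) (sym (-1*x≈-x _))) ⟩
    sum (λ i → - 1# * (f i * x i))   ≈⟨ *-distribˡ-sum (- 1#) (λ i → f i * x i) ⟨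
    - 1# * (f • x)                   ≈⟨ -1*x≈-x _ ⟩
    - (f • x)                        ∎

  •-scale : ∀ {n} (h x : Fin n → Carrier) a → h • (λ t → x t * a) ≈ (h • x) * a
  •-scale {n} h x a = trans (sum-cong-≋ λ (t : Fin n) → sym (*-assoc (h t) (x t) a))
    (sym (*-distribʳ-sum a (λ t → h t * x t)))

  combination-• : ∀ {q n} (a : Fin q → Carrier) (ℓ : Fin q → Fin n → Carrier) x →
    (λ t → sum (λ j → a j * ℓ j t)) • x ≈ sum (λ j → a j * (ℓ j • x))
  combination-• {q} {n} a ℓ x = begin
    sum (λ t → sum (λ j → a j * ℓ j t) * x t)
      ≈⟨ sum-cong-≋ (λ (t : Fin n) → *-distribʳ-sum (x t) (λ j → a j * ℓ j t)) ⟩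
    sum (λ t → sum (λ j → a j * ℓ j t * x t))
      ≈⟨ ∑-comm (λ t j → a j * ℓ j t * x t) ⟩
    sum (λ j → sum (λ t → a j * ℓ j t * x t))
      ≈⟨ sum-cong-≋ (λ (j : Fin q) → trans (sum-cong-≋ λ (t : Fin n) → *-assoc (a j) (ℓ j t) (x t))
                                           (sym (*-distribˡ-sum (a j) (λ t → ℓ j t * x t)))) ⟩
    sum (λ j → a j * (ℓ j • x)) ∎

  negate-dependency : ∀ {n p} {X : Fin n → Fin p → Carrier} {c} → Dependency X c → Dependency X (negate c)
  negate-dependency {X = X} {c} dep j = trans (negate-• c (λ i → X i j)) (x≈0⇒-x≈0 (dep j))

  module _ {n d} (X : Fin n → Fin (suc d) → Carrier) where

    Valid : (Fin (suc d) → Carrier) → Set _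
    Valid h = ∀ v → 0# ≤ h • X v

    Supports : (Fin (suc d) → Carrier) → Subset n → Set _
    Supports h S = Valid h × ∀ v → (h • X v ≈ 0#) ⇔ v ∈ S

    -- The facets F j ⊆ {0, …, n-1} come with inner normals L j; points and
    -- functionals are homogenised, so both live in dimension d + 1.
    record NeighborlyPolytope (k m : ℕ) : Set (c ⊔ ℓ₁ ⊔ ℓ₂) where
      field
        k<n        : k ℕ.< n
        neighborly : ∀ S → ∣ S ∣ ≡ k → ∃ λ h → Supports h S
        base       : Fin (suc d) → Fin n
        base-indep : Independent (X ∘ base)
        F          : Fin m → Subset n
        L          : Fin m → Fin (suc d) → Carrier
        L-supports : ∀ j → Supports (L j) (F j)
        proper     : ∀ j → ∃ λ v → v ∉ F j
        complete   : ∀ {h S} → Supports h S → (∃ λ v → v ∉ S) →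
                     (b : Fin d → Fin n) → Injective _≡_ _≡_ b → (∀ i → b i ∈ S) →
                     Independent (X ∘ b) → ∃ λ j → F j ≡ S

  module _ {n d k m} {X : Fin n → Fin (suc d) → Carrier} (P : NeighborlyPolytope X k m) where

    open NeighborlyPolytope P

    Vec : Set c
    Vec = Fin (suc d) → Carrier

    ∈F⇒L≈0 : ∀ {j v} → v ∈ F j → L j • X v ≈ 0#
    ∈F⇒L≈0 {j} {v} = from (proj₂ (L-supports j) v)

    L≈0⇒∈F : ∀ {j v} → L j • X v ≈ 0# → v ∈ F j
    L≈0⇒∈F {j} {v} = to (proj₂ (L-supports j) v)

    -- Applying `h` turns the dependency into a vanishing sum of nonnegative terms, and `h` is
    -- nonzero off `S`.
    supports-sign : ∀ h {S} → Supports X h S → ∀ {c} → Dependency X c →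
      (∀ v → v ∉ S → 0# ≤ c v) → ∀ v → v ∉ S → c v ≈ 0#
    supports-sign h {S} (valid , exact) {c} dep 0≤c v v∉S =
      *-cancel-≈0 (v∉S ∘ to (exact v)) (trans (*-comm _ _) (nonneg-sum-zero 0≤term (dependency-• X c dep h) v))
      where
      0≤term : ∀ v → 0# ≤ c v * (h • X v)
      0≤term v with v ∈? S
      ... | yes v∈S = ≤-reflexive (sym (trans (*-congˡ (from (exact v) v∈S)) (zeroʳ _)))
      ... | no  v∉S = *-nonneg (0≤c v v∉S) (valid v)

    avoiding : ∀ {S v} → v ∉ S → ∣ S ∣ ℕ.≤ k → ∃ λ S′ → S ⊆ S′ × v ∉ S′ × ∣ S′ ∣ ≡ k
    avoiding {S} {v} v∉S S≤k with interpolate S (∁ ⁅ v ⁆)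
      (λ {x} x∈S → x∉p⇒x∈∁p (x≢y⇒x∉⁅y⁆ λ x≡v → v∉S (≡.subst (_∈ S) x≡v x∈S))) S≤k
      (≡.subst (k ℕ.≤_) (≡.sym (≡.trans (∣∁p∣≡n∸∣p∣ ⁅ v ⁆) (≡.cong (n ℕ.∸_) (∣⁅x⁆∣≡1 v)))) (ℕ.∸-monoˡ-≤ 1 k<n))
    ... | S′ , S⊆S′ , S′⊆ , eq = S′ , S⊆S′ , (λ v∈S′ → x∈∁p⇒x∉p (S′⊆ v∈S′) (x∈⁅x⁆ v)) , eq

    nonneg⇒zero-off : ∀ {S} → ∣ S ∣ ℕ.≤ k → ∀ {c} → Dependency X c →
      (∀ v → v ∉ S → 0# ≤ c v) → ∀ v → v ∉ S → c v ≈ 0#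
    nonneg⇒zero-off S≤k dep 0≤c v v∉S with avoiding v∉S S≤k
    ... | S′ , S⊆S′ , v∉S′ , eq = supports-sign (proj₁ (neighborly S′ eq)) (proj₂ (neighborly S′ eq)) dep
      (λ w w∉S′ → 0≤c w (w∉S′ ∘ S⊆S′)) v v∉S′

    nonneg⇒zero-on : ∀ {S v} → ∣ S ∣ ℕ.≤ k → v ∈ S → ∀ {c} → Dependency X c →
      (∀ w → w ∉ S → 0# ≤ c w) → 0# ≤ c v → c v ≈ 0#
    nonneg⇒zero-on {S} {v} S≤k v∈S {c} dep 0≤c 0≤cᵥ
      with avoiding {S ∩ ∁ ⁅ v ⁆} {v} (λ v∈ → x∈∁p⇒x∉p (proj₂ (x∈p∩q⁻ S _ v∈)) (x∈⁅x⁆ v))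
             (ℕ.≤-trans (∣p∩q∣≤∣p∣ S (∁ ⁅ v ⁆)) S≤k)
    ... | S′ , S∖v⊆S′ , v∉S′ , eq = supports-sign (proj₁ (neighborly S′ eq)) (proj₂ (neighborly S′ eq)) dep 0≤c′ v v∉S′
      where
      0≤c′ : ∀ w → w ∉ S′ → 0# ≤ c w
      0≤c′ w w∉S′ with w ∈? S | w Fin.≟ v
      ... | no w∉S | _          = 0≤c w w∉S
      ... | yes _  | yes ≡.refl = 0≤cᵥ
      ... | yes w∈S | no w≢v    = contradiction (S∖v⊆S′ (x∈p∩q⁺ (w∈S , x∉p⇒x∈∁p (x≢y⇒x∉⁅y⁆ w≢v)))) w∉S′

    -- The coefficients off `S` vanish first; then both `c` and its negative are nonnegative there,
    -- so either sign inside `S` can be handled.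
    nonneg-off-small : ∀ {S} → ∣ S ∣ ℕ.≤ k → ∀ {c} → Dependency X c →
      (∀ v → v ∉ S → 0# ≤ c v) → ∀ v → c v ≈ 0#
    nonneg-off-small {S} S≤k {c} dep 0≤c v with v ∈? S | total 0# (c v)
    ... | no v∉S  | _         = nonneg⇒zero-off S≤k dep 0≤c v v∉S
    ... | yes v∈S | inj₁ 0≤cᵥ = nonneg⇒zero-on S≤k v∈S dep 0≤c 0≤cᵥ
    ... | yes v∈S | inj₂ cᵥ≤0 = -x≈0⇒x≈0 (nonneg⇒zero-on S≤k v∈S (negate-dependency {X = X} dep)
      (λ w w∉S → ≤-reflexive (sym (x≈0⇒-x≈0 (nonneg⇒zero-off S≤k dep 0≤c w w∉S)))) (0≤-x cᵥ≤0))

    -- Radon: both sides of a Radon partition have more than k points.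
    radon : ∀ {Q} → ∣ Q ∣ ℕ.≤ suc (k ℕ.+ k) → ∀ {c} → Dependency X c →
      (∀ v → v ∉ Q → c v ≈ 0#) → ∀ v → c v ≈ 0#
    radon {Q} Q≤ {c} dep supp with split (λ v → total (c v) 0#) Q
    ... | S₁ , S₂ , eq , 0≤c , c≤0 with ∣ S₁ ∣ ℕ.≤? k
    ...   | yes S₁≤k = nonneg-off-small S₁≤k dep 0≤c′
      where
      0≤c′ : ∀ v → v ∉ S₁ → 0# ≤ c v
      0≤c′ v v∉S₁ with v ∈? Q
      ... | yes v∈Q = 0≤c v∈Q v∉S₁
      ... | no  v∉Q = ≤-reflexive (sym (supp v v∉Q))
    ...   | no  S₁≰k = λ v → -x≈0⇒x≈0 (nonneg-off-small S₂≤k (negate-dependency {X = X} dep) 0≤-c v)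
      where
      S₂≤k : ∣ S₂ ∣ ℕ.≤ k
      S₂≤k = ℕ.+-cancelˡ-≤ (suc k) _ _ (ℕ.≤-trans (ℕ.+-monoˡ-≤ ∣ S₂ ∣ (ℕ.≰⇒> S₁≰k)) (≡.subst (ℕ._≤ suc (k ℕ.+ k)) (≡.sym eq) Q≤))
      0≤-c : ∀ v → v ∉ S₂ → 0# ≤ - c v
      0≤-c v v∉S₂ with v ∈? Q
      ... | yes v∈Q = 0≤-x (c≤0 v∈Q v∉S₂)
      ... | no  v∉Q = ≤-reflexive (sym (x≈0⇒-x≈0 (supp v v∉Q)))

    -- Otherwise some D + 1 - t points of `Q` are dependent, as they lie in a kernel of dimension D
    -- - t; but D ≤ t + 2k bounds their number by 2k + 1, within the reach of `radon`.
    rank-bound : ∀ {t} (ℓ y : Fin t → Vec) → (∀ i → ℓ i • y i ≈ 1#) → (∀ {i j} → i ≢ j → ℓ i • y j ≈ 0#) →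
      ∀ {Q} → (∀ i {v} → v ∈ Q → ℓ i • X v ≈ 0#) → suc d ℕ.≤ t ℕ.+ (k ℕ.+ k) → t ℕ.+ ∣ Q ∣ ℕ.≤ suc d
    rank-bound {t} ℓ y diag off {Q} kills D≤ = decidable-stable (_ ℕ.≤? _) λ large →
      let
        D<t+Q = ℕ.≰⇒> large
        Q′ , _ , Q′⊆Q , eq = interpolate ⊥ Q (λ v∈⊥ → contradiction v∈⊥ ∉⊥)
          (≡.subst (ℕ._≤ suc (suc d) ℕ.∸ t) (≡.sym (∣⊥∣≡0 n)) ℕ.z≤n)
          (ℕ.m≤n+o⇒m∸n≤o (suc (suc d)) t D<t+Q)
      in dependent-in-kernel X Q′ ℓ y diag off (λ i → kills i ∘ Q′⊆Q)
           (≡.subst (λ s → suc d ℕ.< t ℕ.+ s) (≡.sym eq) (ℕ.m≤n+m∸n (suc (suc d)) t))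
           λ (c , supp , (v , cᵥ≉0) , dep) → cᵥ≉0 (radon {Q′}
             (≡.subst (ℕ._≤ suc (k ℕ.+ k)) (≡.sym eq)
               (ℕ.m≤n+o⇒m∸n≤o (suc (suc d)) t (≡.subst (suc (suc d) ℕ.≤_) (≡.sym (ℕ.+-suc t _)) (ℕ.s≤s D≤))))
             dep supp v)

    -- Facets by rotation of supporting functionals.

    nonvanishing : ∀ {h y} → ¬ h • y ≈ 0# → ¬ ¬ ∃ λ v → ¬ h • X v ≈ 0#
    nonvanishing {h} {y} hy≉0 none = ¬¬-∀ (λ i hbᵢ≉0 → none (base i , hbᵢ≉0)) λ hb≈0 →
      zero-on-basis {b = X ∘ base} h base-indep hb≈0 y hy≉0

    -- The vector `g` itself is a witness for `nonvanishing`: a sum of squares vanishes only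
    -- termwise.
    nonvanishing′ : ∀ {g} → (∃ λ j → ¬ g j ≈ 0#) → ¬ ¬ ∃ λ v → ¬ g • X v ≈ 0#
    nonvanishing′ {g} (j , gⱼ≉0) = nonvanishing {g} {g} λ gg≈0 →
      *-nonzero gⱼ≉0 gⱼ≉0 (nonneg-sum-zero (λ i → x*x-nonneg (g i)) gg≈0 j)

    -- Up to the factor e(q) this is `h` minus h(q)/e(q) times `e`, the member of the pencil that
    -- vanishes at `X q`; the division is cleared.
    turn : Vec → Vec → Fin n → Vec
    turn h e q = comb (e • X q) h (- (h • X q)) e

    module _ {h e : Vec} {q : Fin n} where

      turn-zero : ∀ {y} → h • y ≈ 0# → e • y ≈ 0# → turn h e q • y ≈ 0#
      turn-zero {y} hy≈0 ey≈0 = trans (comb-• _ h _ e y) (trans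
        (+-cong (trans (*-congˡ hy≈0) (zeroʳ _)) (trans (*-congˡ ey≈0) (zeroʳ _))) (+-identityˡ 0#))

      turn-self : turn h e q • X q ≈ 0#
      turn-self = trans (comb-• _ h _ e (X q)) (trans
        (+-cong (*-comm _ _) (sym (-‿distribˡ-* _ _))) (-‿inverseʳ _))

      turn≉0 : ∀ {y} → e • y ≈ 0# → ¬ e • X q ≈ 0# → ¬ h • y ≈ 0# → ¬ turn h e q • y ≈ 0#
      turn≉0 {y} ey≈0 eq≉0 hy≉0 uy≈0 = *-nonzero eq≉0 hy≉0 (trans (sym (trans (comb-• _ h _ e y)
        (trans (+-congˡ (trans (*-congˡ ey≈0) (zeroʳ _))) (+-identityʳ _)))) uy≈0)

      turn≉0′ : ∀ {y} → h • y ≈ 0# → ¬ h • X q ≈ 0# → ¬ e • y ≈ 0# → ¬ turn h e q • y ≈ 0#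
      turn≉0′ {y} hy≈0 hq≉0 ey≉0 uy≈0 = *-nonzero (-x≉0 hq≉0) ey≉0 (trans (sym (trans (comb-• _ h _ e y)
        (trans (+-congʳ (trans (*-congˡ hy≈0) (zeroʳ _))) (+-identityˡ _)))) uy≈0)

    -- The vertex `q` where e/h is maximal is the first one that the turning functional meets, so no
    -- value has become negative; `p` ensures that some vertex is met.
    rotate : ∀ h e → Valid X h → (∀ v → h • X v ≈ 0# → e • X v ≈ 0#) →
      ∀ p → 0# ≤ e • X p → ¬ e • X p ≈ 0# →
      ¬ ¬ ∃ λ q → ¬ h • X q ≈ 0# × ¬ e • X q ≈ 0# × Valid X (turn h e q)
    rotate h e valid h⇒e p 0≤eₚ eₚ≉0 = do
      h≟0 ← ¬¬-∀ {P = λ v → Dec (h • X v ≈ 0#)} (λ v → ¬¬-excluded-middle)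
      let q , hq≉0 , eq≉0 , max = max-ratio (λ v → h • X v) (λ v → e • X v) valid h≟0 h⇒e p 0≤eₚ eₚ≉0
      pure (q , hq≉0 , eq≉0 , λ v → ≤-respʳ-≈
        (sym (trans (comb-• _ h _ e (X v)) (+-congˡ (sym (-‿distribˡ-* _ _))))) (0≤y-x (max v)))

    rotate± : ∀ h e → Valid X h → (∀ v → h • X v ≈ 0# → e • X v ≈ 0#) → ∀ p → ¬ e • X p ≈ 0# →
      ¬ ¬ ∃ λ e′ → (∀ y → e • y ≈ 0# → e′ • y ≈ 0#) × (∀ y → e′ • y ≈ 0# → e • y ≈ 0#) ×
        ∃ λ q → ¬ h • X q ≈ 0# × ¬ e′ • X q ≈ 0# × Valid X (turn h e′ q)
    rotate± h e valid h⇒e p eₚ≉0 with total 0# (e • X p)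
    ... | inj₁ 0≤eₚ = do
      rotated ← rotate h e valid h⇒e p 0≤eₚ eₚ≉0
      pure (e , (λ _ → id) , (λ _ → id) , rotated)
    ... | inj₂ eₚ≤0 = do
      rotated ← rotate h (negate e) valid (λ v → ⇒- (X v) ∘ h⇒e v) p
        (≤-respʳ-≈ (sym (negate-• e (X p))) (0≤-x eₚ≤0)) (eₚ≉0 ∘ -⇒ (X p))
      pure (negate e , ⇒- , -⇒ , rotated)
      where
      ⇒- : ∀ y → e • y ≈ 0# → negate e • y ≈ 0#
      ⇒- y ey≈0 = trans (negate-• e y) (x≈0⇒-x≈0 ey≈0)
      -⇒ : ∀ y → negate e • y ≈ 0# → e • y ≈ 0#
      -⇒ y -ey≈0 = -x≈0⇒x≈0 (trans (sym (negate-• e y)) -ey≈0)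

    ◂-injective : ∀ {r z} {b : Fin r → Fin n} g → Injective _≡_ _≡_ b → (∀ i → g • X (b i) ≈ 0#) →
      ¬ g • X z ≈ 0# → Injective _≡_ _≡_ (z ◂ b)
    ◂-injective {r} {z} {b} g inj gb≈0 gz≉0 = injective
      where
      b≢z : ∀ i → b i ≢ z
      b≢z i ≡.refl = gz≉0 (gb≈0 i)
      injective : Injective _≡_ _≡_ (z ◂ b)
      injective {zero}  {zero}  _  = ≡.refl
      injective {zero}  {suc j} eq = contradiction (≡.sym eq) (b≢z j)
      injective {suc i} {zero}  eq = contradiction eq (b≢z i)
      injective {suc i} {suc j} eq = ≡.cong suc (inj eq)

    -- `y` is an arbitrary vector because it will be a vertex, a projected vertex or an edge
    -- direction.
    FacetAvoiding : Vec → Vec → Set _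
    FacetAvoiding h y = ∃ λ j → (∀ v → h • X v ≈ 0# → v ∈ F j) × ¬ L j • y ≈ 0#

    -- `s` counts the independent vertices that the face of `h` still lacks. A functional `g`
    -- killing `b` and `y` either reveals one on the face, or vanishes on the whole face and serves
    -- to rotate `h` onto a new vertex. As `g` kills `y`, the rotated functional stays nonzero at
    -- `y`.
    facet-avoiding-from : ∀ s {r} → r ℕ.+ s ≡ d → ∀ h → Valid X h →
      (b : Fin r → Fin n) → Injective _≡_ _≡_ b → Independent (X ∘ b) → (∀ i → h • X (b i) ≈ 0#) →
      ∀ y → ¬ h • y ≈ 0# → ¬ ¬ FacetAvoiding h y
    facet-avoiding-from zero {r} r≡d h valid b inj ind hb≈0 y hy≉0
      with ≡.refl ← ≡.trans (≡.sym (ℕ.+-identityʳ r)) r≡d = do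
      h≟0 ← ¬¬-∀ {P = λ v → Dec (h • X v ≈ 0#)} (λ v → ¬¬-excluded-middle)
      v , hv≉0 ← nonvanishing {h} {y} hy≉0
      let
        exact : ∀ v → (h • X v ≈ 0#) ⇔ v ∈ subset h≟0
        exact v = mk⇔ (∈-subset⁺ h≟0) (∈-subset⁻ h≟0)
        j , Fⱼ≡ = complete {h} (valid , exact) (v , hv≉0 ∘ ∈-subset⁻ h≟0) b inj (∈-subset⁺ h≟0 ∘ hb≈0) ind
        L≈0 : ∀ {v} → h • X v ≈ 0# → L j • X v ≈ 0#
        L≈0 {v} hv≈0 = ∈F⇒L≈0 (≡.subst (v ∈_) (≡.sym Fⱼ≡) (∈-subset⁺ h≟0 hv≈0))
        w , w∉Fⱼ = proper j
      -- A normal vanishing at `y` would vanish on the basis formed by `y` and `b`, hence at every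
      -- vertex, contrary to `proper`.
      pure (j , (λ v hv≈0 → ≡.subst (v ∈_) (≡.sym Fⱼ≡) (∈-subset⁺ h≟0 hv≈0)) , λ Ly≈0 →
        zero-on-basis {b = y ◂ (X ∘ b)} (L j) (independent-◂ h ind hb≈0 hy≉0)
          (λ where zero    → Ly≈0
                   (suc i) → L≈0 (hb≈0 i))
          (X w) (w∉Fⱼ ∘ L≈0⇒∈F))
    facet-avoiding-from (suc s) {r} r+s≡d h valid b inj ind hb≈0 y hy≉0 = do
      g , g≉0 , gyb≈0 ← common-zero (y ◂ (X ∘ b)) (ℕ.s≤s r<d)
      p , gₚ≉0 ← nonvanishing′ g≉0
      g≟0 ← ¬¬-∀ {P = λ v → Dec (g • X v ≈ 0#)} (λ v → ¬¬-excluded-middle)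
      yes (z , hz≈0 , gz≉0) ← ¬¬-excluded-middle {A = ∃ λ z → h • X z ≈ 0# × ¬ g • X z ≈ 0#}
        where
        no none → do
          e , g⇒e , _ , q , hq≉0 , eq≉0 , valid′ ← rotate± h g valid
            (λ v hv≈0 → decidable-stable (g≟0 v) λ gv≉0 → none (v , hv≈0 , gv≉0)) p gₚ≉0
          j , ⊆Fⱼ , Ly≉0 ← facet-avoiding-from s (≡.trans (≡.sym (ℕ.+-suc r s)) r+s≡d) (turn h e q) valid′
            (q ◂ b) (◂-injective h inj hb≈0 hq≉0) (independent-◂ h ind hb≈0 hq≉0)
            (λ where zero    → turn-self {h} {e} {q}
                     (suc i) → turn-zero {h} {e} {q} {X (b i)} (hb≈0 i) (g⇒e (X (b i)) (gyb≈0 (suc i))))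
            y (turn≉0 {h} {e} {q} {y} (g⇒e y (gyb≈0 zero)) eq≉0 hy≉0)
          pure (j , (λ v hv≈0 → ⊆Fⱼ v (turn-zero {h} {e} {q} {X v} hv≈0 (g⇒e (X v)
            (decidable-stable (g≟0 v) λ gv≉0 → none (v , hv≈0 , gv≉0))))) , Ly≉0)
      facet-avoiding-from s (≡.trans (≡.sym (ℕ.+-suc r s)) r+s≡d) h valid
        (z ◂ b) (◂-injective g inj (gyb≈0 ∘ suc) gz≉0) (independent-◂ g ind (gyb≈0 ∘ suc) gz≉0)
        (λ where zero    → hz≈0
                 (suc i) → hb≈0 i)
        y hy≉0
      where
      r<d : r ℕ.< d
      r<d = ≡.subst (suc r ℕ.≤_) (≡.trans (≡.sym (ℕ.+-suc r s)) r+s≡d) (ℕ.m≤m+n (suc r) s)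

    facet-avoiding : ∀ h → Valid X h → ∀ y → ¬ h • y ≈ 0# → ¬ ¬ FacetAvoiding h y
    facet-avoiding h valid = facet-avoiding-from d ≡.refl h valid (λ ()) (λ {}) (λ _ _ ()) (λ ())

    -- R lists the points of A and the y i up to span; proj moves x along the y i
    -- into the common kernel of the normals, so functionals killing R do not notice.
    record Frame (A : Subset n) (r : ℕ) : Set (c ⊔ ℓ₁) where
      field
        φ     : Fin r → Fin m
        A⊆F   : ∀ i → A ⊆ F (φ i)
        y     : Fin r → Vec
        diag  : ∀ i → L (φ i) • y i ≈ 1#
        off   : ∀ {i j} → i ≢ j → L (φ i) • y j ≈ 0#
        R     : Fin (r ℕ.+ k) → Vec
        kills : ∀ g → (∀ s → g • R s ≈ 0#) → ∀ {a} → a ∈ A → g • X a ≈ 0#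
        proj  : ∀ x → ∃ λ x′ → (∀ i → L (φ i) • x′ ≈ 0#) ×
                (∀ g → (∀ s → g • R s ≈ 0#) → g • x′ ≈ g • x)

      φ-injective : Injective _≡_ _≡_ φ
      φ-injective {i} {j} eq with i Fin.≟ j
      ... | yes i≡j = i≡j
      ... | no  i≢j = contradiction
        (trans (sym (off i≢j)) (≡.subst (λ l → L l • y j ≈ 1#) (≡.sym eq) (diag j))) 0≉1

    empty-frame : ∀ {A} → ∣ A ∣ ≡ k → Frame A 0
    empty-frame {A} ≡.refl with enumerate A
    ... | e , _ , _ , onto = record
      { φ     = λ ()
      ; A⊆F   = λ ()
      ; y     = λ ()
      ; diag  = λ ()
      ; off   = λ { {()} }
      ; R     = X ∘ e
      ; kills = λ g gR≈0 a∈A → let t , eq = onto a∈A in ≡.subst (λ a → g • X a ≈ 0#) eq (gR≈0 t)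
      ; proj  = λ x → x , (λ ()) , λ _ _ → refl
      }

    -- All earlier normals kill `x`, so its multiple `y₀` is dual to `L j` alone; subtracting
    -- multiples of `y₀` moves the old `y i` into the kernel of `L j` without changing their earlier
    -- values.
    extend-frame : ∀ {A r} (fr : Frame A r) j → A ⊆ F j → ∀ x →
      (∀ i → L (Frame.φ fr i) • x ≈ 0#) → ¬ L j • x ≈ 0# → Frame A (suc r)
    extend-frame {A} {r} fr j A⊆Fⱼ x Lx≈0 Lⱼx≉0 = record
      { φ     = j ◂ φ
      ; A⊆F   = λ where
          zero    → A⊆Fⱼ
          (suc i) → A⊆F i
      ; y     = y₀ ◂ y₊
      ; diag  = λ where
          zero    → Lⱼy₀≈1
          (suc i) → trans (Ly₊ i i) (diag i)
      ; off   = off₊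
      ; R     = y₀ ◂ R
      ; kills = λ g gR≈0 → kills g (gR≈0 ∘ suc)
      ; proj  = λ z → project z (proj z)
      }
      where
      open Frame fr
      w : Carrier
      w = proj₁ (inverse (L j • x) Lⱼx≉0)
      y₀ : Vec
      y₀ t = x t * w
      L•y₀ : ∀ ℓ → ℓ • y₀ ≈ (ℓ • x) * w
      L•y₀ ℓ = •-scale ℓ x w
      Lⱼy₀≈1 : L j • y₀ ≈ 1#
      Lⱼy₀≈1 = trans (L•y₀ (L j)) (proj₂ (inverse (L j • x) Lⱼx≉0))
      Lᵢy₀≈0 : ∀ i → L (φ i) • y₀ ≈ 0#
      Lᵢy₀≈0 i = trans (L•y₀ (L (φ i))) (trans (*-congʳ (Lx≈0 i)) (zeroˡ w))
      subtract : Vec → Vec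
      subtract z = comb 1# z (- (L j • z)) y₀
      subtract-unchanged : ∀ g z → g • y₀ ≈ 0# → g • subtract z ≈ g • z
      subtract-unchanged g z gy₀≈0 = trans (•-comb g 1# z (- (L j • z)) y₀)
        (trans (+-cong (*-identityˡ _) (trans (*-congˡ gy₀≈0) (zeroʳ _))) (+-identityʳ _))
      Lⱼ-subtract : ∀ z → L j • subtract z ≈ 0#
      Lⱼ-subtract z = trans (•-comb (L j) 1# z (- (L j • z)) y₀)
        (trans (+-cong (*-identityˡ _) (trans (*-congˡ Lⱼy₀≈1) (*-identityʳ _))) (-‿inverseʳ _))
      y₊ : Fin r → Vec
      y₊ i = subtract (y i)
      Ly₊ : ∀ i i′ → L (φ i) • y₊ i′ ≈ L (φ i) • y i′
      Ly₊ i i′ = subtract-unchanged (L (φ i)) (y i′) (Lᵢy₀≈0 i)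
      off₊ : ∀ {i i′} → i ≢ i′ → L ((j ◂ φ) i) • (y₀ ◂ y₊) i′ ≈ 0#
      off₊ {zero}  {zero}   i≢i′ = contradiction ≡.refl i≢i′
      off₊ {zero}  {suc i′} i≢i′ = Lⱼ-subtract (y i′)
      off₊ {suc i} {zero}   i≢i′ = Lᵢy₀≈0 i
      off₊ {suc i} {suc i′} i≢i′ = trans (Ly₊ i i′) (off (i≢i′ ∘ ≡.cong suc))
      project : ∀ z → (∃ λ z′ → (∀ i → L (φ i) • z′ ≈ 0#) × (∀ g → (∀ s → g • R s ≈ 0#) → g • z′ ≈ g • z)) →
        ∃ λ z′ → (∀ i → L ((j ◂ φ) i) • z′ ≈ 0#) × (∀ g → (∀ s → g • (y₀ ◂ R) s ≈ 0#) → g • z′ ≈ g • z)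
      project z (z′ , Lz′≈0 , same) = subtract z′ ,
        (λ where
          zero    → Lⱼ-subtract z′
          (suc i) → trans (subtract-unchanged (L (φ i)) z′ (Lᵢy₀≈0 i)) (Lz′≈0 i)) ,
        λ g gR≈0 → trans (subtract-unchanged g z′ (gR≈0 zero)) (same g (gR≈0 ∘ suc))

    -- `R` has fewer than D entries, so some nonzero `g` kills it. Projecting a vertex where `g` is
    -- nonzero gives an `x` seen by `g` but by none of the normals so far; any facet through `A`
    -- whose normal sees `x` is therefore new.
    grow-frame : ∀ {A r} → ∣ A ∣ ≡ k → r ℕ.+ k ℕ.< suc d → Frame A r → ¬ ¬ Frame A (suc r)
    grow-frame {A} {r} A≡k r+k<D fr = do
      let h , valid , exact = neighborly A A≡k
      g , g≉0 , gR≈0 ← common-zero R r+k<D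
      p , gₚ≉0 ← nonvanishing′ g≉0
      let
        x , Lx≈0 , same = proj (X p)
        gx≉0 : ¬ g • x ≈ 0#
        gx≉0 gx≈0 = gₚ≉0 (trans (sym (same g gR≈0)) gx≈0)
      no hx≉0 ← ¬¬-excluded-middle {A = h • x ≈ 0#}
        where
        -- Turning towards `g` makes the functional nonzero at `x`, and it still vanishes on `A`
        -- because `g` does.
        yes hx≈0 → do
          e , g⇒e , e⇒g , q , hq≉0 , eq≉0 , valid′ ← rotate± h g valid
            (λ v hv≈0 → kills g gR≈0 (to (exact v) hv≈0)) p gₚ≉0
          j , ⊆Fⱼ , Lⱼx≉0 ← facet-avoiding (turn h e q) valid′ x
            (turn≉0′ {h} {e} {q} {x} hx≈0 hq≉0 (gx≉0 ∘ e⇒g x))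
          pure (extend-frame fr j
            (λ {a} a∈A → ⊆Fⱼ a (turn-zero {h} {e} {q} {X a} (from (exact a) a∈A) (g⇒e (X a) (kills g gR≈0 a∈A))))
            x Lx≈0 Lⱼx≉0)
      j , ⊆Fⱼ , Lⱼx≉0 ← facet-avoiding h valid x hx≉0
      pure (extend-frame fr j (λ {a} a∈A → ⊆Fⱼ a (from (exact a) a∈A)) x Lx≈0 Lⱼx≉0)
      where
      open Frame fr

    frame : ∀ {A} → ∣ A ∣ ≡ k → ∀ r → r ℕ.+ k ℕ.≤ suc d → ¬ ¬ Frame A r
    frame A≡k zero    _     = pure (empty-frame A≡k)
    frame A≡k (suc r) r+k<D = do
      fr ← frame A≡k r (ℕ.<⇒≤ r+k<D)
      grow-frame A≡k r+k<D fr

    -- Facets as blocks of the double count.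

    open DoubleCounting F

    frame-counting : ∀ {q} → q ℕ.+ k ≡ suc d → suc d ℕ.≤ k ℕ.+ (k ℕ.+ k) → ∀ {A} → Frame A q →
      ∃ λ B → q ℕ.≤ ∣ B ∣ × B ⊆ containing A × (∀ T → T ⊆ B → ∣ T ∣ ≡ k → ∣ common T ∣ ℕ.≤ q)
    frame-counting {q} q+k≡D D≤3k {A} fr = B ,
      injection⇒≤∣∣ B φ φ-injective (λ i → ∈-subset⁺ {P = Image} image? (i , ≡.refl)) ,
      (λ j∈B → let i , eq = ∈-subset⁻ {P = Image} image? j∈B in
        ∈-containing⁺ (≡.subst (λ j → A ⊆ F j) eq (A⊆F i))) ,
      small
      where
      open Frame fr
      Image : Fin m → Set
      Image j = ∃ λ i → φ i ≡ j
      image? : ∀ j → Dec (Image j)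
      image? j = Fin.any? λ i → φ i Fin.≟ j
      B : Subset m
      B = subset image?
      small : ∀ T → T ⊆ B → ∣ T ∣ ≡ k → ∣ common T ∣ ℕ.≤ q
      small T T⊆B eq with enumerate T
      ... | e , e-inj , e∈T , _ = ℕ.+-cancelˡ-≤ k _ _ (≡.subst (k ℕ.+ ∣ common T ∣ ℕ.≤_)
        (≡.trans (≡.sym q+k≡D) (ℕ.+-comm q k))
        (≡.subst (λ t → t ℕ.+ ∣ common T ∣ ℕ.≤ suc d) eq (rank-bound (L ∘ φ ∘ τ) (y ∘ τ) (diag ∘ τ)
          (λ i≢j → off (i≢j ∘ τ-injective)) {common T}
          (λ i v∈ → ∈F⇒L≈0 (∈-common⁻ v∈ (≡.subst (_∈ T) (≡.sym (φτ i)) (e∈T i))))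
          (≡.subst (λ t → suc d ℕ.≤ t ℕ.+ (k ℕ.+ k)) (≡.sym eq) D≤3k))))
        where
        τ : Fin ∣ T ∣ → Fin q
        τ i = proj₁ (∈-subset⁻ {P = Image} image? (T⊆B (e∈T i)))
        φτ : ∀ i → φ (τ i) ≡ e i
        φτ i = proj₂ (∈-subset⁻ {P = Image} image? (T⊆B (e∈T i)))
        τ-injective : Injective _≡_ _≡_ τ
        τ-injective {i} {j} eq = e-inj (≡.trans (≡.sym (φτ i)) (≡.trans (≡.cong φ eq) (φτ j)))

    -- The case of equality.

    module Tight {q} (few : ∀ A → ∣ A ∣ ≡ k → ∣ containing A ∣ ℕ.≤ q) where

      frame-complete : ∀ {A} → ∣ A ∣ ≡ k → (fr : Frame A q) → ∀ {j} → A ⊆ F j → ∃ λ i → Frame.φ fr i ≡ j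
      frame-complete {A} A≡k fr {j} A⊆Fⱼ = decidable-stable (Fin.any? λ i → φ i Fin.≟ j) λ none →
        ℕ.<⇒≱ (injection⇒≤∣∣ (containing A) (j ◂ φ) (injective none) (λ where
            zero    → ∈-containing⁺ A⊆Fⱼ
            (suc i) → ∈-containing⁺ (A⊆F i)))
          (few A A≡k)
        where
        open Frame fr
        injective : (¬ ∃ λ i → φ i ≡ j) → Injective _≡_ _≡_ (j ◂ φ)
        injective none {zero}  {zero}  _  = ≡.refl
        injective none {zero}  {suc i} eq = contradiction (i , ≡.sym eq) none
        injective none {suc i} {zero}  eq = contradiction (i , eq) none
        injective none {suc _} {suc _} eq = ≡.cong suc (φ-injective eq)

      -- If the edge direction y i met no vertex, then turning the sum of the
      -- other normals towards L (φ i) would produce a facet through A different from all F (φ j).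
      edge : ∀ {A} → ∣ A ∣ ≡ k → (fr : Frame A q) → ∀ i →
        ¬ ¬ ∃ λ w → w ∉ F (Frame.φ fr i) × ∀ j → j ≢ i → w ∈ F (Frame.φ fr j)
      edge {A} A≡k fr i none = rotate h (L (φ i)) h-valid h⇒L p
        (proj₁ (L-supports (φ i)) p) (p∉ ∘ L≈0⇒∈F) λ (w , hw≉0 , Lw≉0 , valid) →
        facet-avoiding (turn h (L (φ i)) w) valid (y i)
          (turn≉0′ {h} {L (φ i)} {w} {y i} hy≈0 hw≉0 λ Ly≈0 → 0≉1 (trans (sym Ly≈0) (diag i)))
          λ (j , ⊆Fⱼ , Lⱼy≉0) → facet-not-new w Lw≉0 j ⊆Fⱼ Lⱼy≉0
            (frame-complete A≡k fr λ {a} a∈A → ⊆Fⱼ a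
              (turn-zero {h} {L (φ i)} {w} {X a} (h≈0 a∈A) (∈F⇒L≈0 (A⊆F i a∈A))))
        where
        open Frame fr
        p : Fin n
        p = proj₁ (proper (φ i))
        p∉ : p ∉ F (φ i)
        p∉ = proj₂ (proper (φ i))
        others : Fin q → Carrier
        others j with j Fin.≟ i
        ... | yes _ = 0#
        ... | no  _ = 1#
        h : Vec
        h t = sum (λ j → others j * L (φ j) t)
        h• : ∀ x → h • x ≈ sum (λ j → others j * (L (φ j) • x))
        h• x = combination-• others (L ∘ φ) x
        0≤others : ∀ j v → 0# ≤ others j * (L (φ j) • X v)
        0≤others j v with j Fin.≟ i
        ... | yes _ = ≤-reflexive (sym (zeroˡ _))
        ... | no  _ = ≤-respʳ-≈ (sym (*-identityˡ _)) (proj₁ (L-supports (φ j)) v)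
        h-valid : Valid X h
        h-valid v = ≤-respʳ-≈ (sym (h• (X v))) (sum-nonneg λ j → 0≤others j v)
        h-zero : ∀ {v} → h • X v ≈ 0# → ∀ j → j ≢ i → v ∈ F (φ j)
        h-zero {v} hv≈0 j j≢i with nonneg-sum-zero (λ j → 0≤others j v) (trans (sym (h• (X v))) hv≈0) j
        ... | termⱼ≈0 with j Fin.≟ i
        ...   | yes j≡i = contradiction j≡i j≢i
        ...   | no  _   = L≈0⇒∈F (trans (sym (*-identityˡ _)) termⱼ≈0)
        h⇒L : ∀ v → h • X v ≈ 0# → L (φ i) • X v ≈ 0#
        h⇒L v hv≈0 = ∈F⇒L≈0 (decidable-stable (v ∈? F (φ i)) λ v∉ → none (v , v∉ , h-zero hv≈0))
        h≈0 : ∀ {a} → a ∈ A → h • X a ≈ 0#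
        h≈0 {a} a∈A = trans (h• (X a)) (sum-zero λ j → trans (*-congˡ (∈F⇒L≈0 (A⊆F j a∈A))) (zeroʳ _))
        othersy≈0 : ∀ j → others j * (L (φ j) • y i) ≈ 0#
        othersy≈0 j with j Fin.≟ i
        ... | yes _   = zeroˡ _
        ... | no  j≢i = trans (*-identityˡ _) (off j≢i)
        hy≈0 : h • y i ≈ 0#
        hy≈0 = trans (h• (y i)) (sum-zero othersy≈0)
        -- Every other normal of the frame kills `y i`, and `F (φ i)` misses the vertex `w` met by
        -- the rotation.
        facet-not-new : ∀ w → ¬ L (φ i) • X w ≈ 0# → ∀ j →
          (∀ v → turn h (L (φ i)) w • X v ≈ 0# → v ∈ F j) → ¬ L j • y i ≈ 0# → ¬ ∃ λ i′ → φ i′ ≡ j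
        facet-not-new w Lw≉0 _ ⊆Fⱼ Lⱼy≉0 (i′ , ≡.refl) with i′ Fin.≟ i
        ... | no i′≢i    = Lⱼy≉0 (off i′≢i)
        ... | yes ≡.refl = Lw≉0 (∈F⇒L≈0 (⊆Fⱼ w (turn-self {h} {L (φ i)} {w})))

  -- Fix a k-set A = E ∪ {v} lying on facets φ i with opposite edges A ∪ {w i},
  -- and a facet H through E ∪ {w 0} missing v. Then H contains every w i, so in a
  -- dependency of a further point u on A ∪ {w i} the signs of all coefficients
  -- outside E ∪ {u} are known, which neighborliness excludes.
  module NoFurtherPoint {n d m k t} {X : Fin n → Fin (suc d) → Carrier}
    (P : NeighborlyPolytope X (suc (suc k)) m)
    (q+k≡D : suc (suc t) ℕ.+ suc (suc k) ≡ suc d)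
    (few : ∀ A → ∣ A ∣ ≡ suc (suc k) →
      ∣ DoubleCounting.containing (NeighborlyPolytope.F P) A ∣ ℕ.≤ suc (suc t))
    where

    open NeighborlyPolytope P hiding (k<n)
    open Tight P few

    module Corner {E v} (E≡ : ∣ E ∣ ≡ suc k) (v∉E : v ∉ E) (fr : Frame P (insert v E) (suc (suc t)))
      (edges : ∀ i → ∃ λ w → w ∉ F (Frame.φ fr i) × ∀ j → j ≢ i → w ∈ F (Frame.φ fr j))
      where

      open Frame fr

      A : Subset n
      A = insert v E

      A≡ : ∣ A ∣ ≡ suc (suc k)
      A≡ = ≡.trans (∣insert∣ v∉E) (≡.cong suc E≡)

      w : Fin (suc (suc t)) → Fin n
      w i = proj₁ (edges i)

      w∉F : ∀ i → w i ∉ F (φ i)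
      w∉F i = proj₁ (proj₂ (edges i))

      w∈F : ∀ {i j} → j ≢ i → w i ∈ F (φ j)
      w∈F {i} {j} = proj₂ (proj₂ (edges i)) j

      w∉A : ∀ i → w i ∉ A
      w∉A i w∈A = w∉F i (A⊆F i w∈A)

      w-injective : Injective _≡_ _≡_ w
      w-injective {i} {j} eq with i Fin.≟ j
      ... | yes i≡j = i≡j
      ... | no  i≢j = contradiction (≡.subst (_∈ F (φ j)) eq (w∈F (i≢j ∘ ≡.sym))) (w∉F j)

      W≡ : ∣ insertAll w A ∣ ≡ suc d
      W≡ = ≡.trans (∣insertAll∣ w w-injective w∉A) (≡.trans (≡.cong (suc (suc t) ℕ.+_) A≡) q+k≡D)

      w₀ : Fin n
      w₀ = w zero

      A′ : Subset n
      A′ = insert w₀ E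

      A′≡ : ∣ A′ ∣ ≡ suc (suc k)
      A′≡ = ≡.trans (∣insert∣ (w∉A zero ∘ ∈-insertʳ)) (≡.cong suc E≡)

      v∉A′ : v ∉ A′
      v∉A′ v∈A′ with ∈-insert⁻ v∈A′
      ... | inj₁ v≡w₀ = w∉A zero (≡.subst (_∈ A) v≡w₀ ∈-insertˡ)
      ... | inj₂ v∈E  = v∉E v∈E

      A′⊆F : ∀ {i} → i ≢ zero → A′ ⊆ F (φ i)
      A′⊆F i≢0 x∈A′ with ∈-insert⁻ x∈A′
      ... | inj₁ ≡.refl = w∈F i≢0
      ... | inj₂ x∈E    = A⊆F _ (∈-insertʳ x∈E)

      module _ {H} (A′⊆H : A′ ⊆ F H) (v∉H : v ∉ F H) where

        -- `H` and the `F (φ i)` with `i ≢ zero` contain `A′` and hence occur in its frame; `x` is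
        -- the end of the edge opposite to `F (φ j)`. `H` is not that facet, since `v` lies on
        -- `F (φ j)`.
        other-end : ∀ {j} → j ≢ zero → ¬ ¬ ∃ λ x → x ∉ F (φ j) × x ∈ F H ×
          ∀ {i} → i ≢ zero → i ≢ j → x ∈ F (φ i)
        other-end {j} j≢0 = do
          fr′ ← frame P A′≡ (suc (suc t)) (ℕ.≤-reflexive q+k≡D)
          let
            s , φ′s≡ = frame-complete A′≡ fr′ (A′⊆F j≢0)
            sH , φ′sH≡ = frame-complete A′≡ fr′ A′⊆H
          x , x∉ , x∈ ← edge A′≡ fr′ s
          let
            lies-on : ∀ l → A′ ⊆ F l → l ≢ φ j → x ∈ F l
            lies-on l A′⊆l l≢ = let sl , φ′sl≡ = frame-complete A′≡ fr′ A′⊆l in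
              ≡.subst (λ l → x ∈ F l) φ′sl≡ (x∈ sl λ sl≡s →
                l≢ (≡.trans (≡.sym φ′sl≡) (≡.trans (≡.cong (Frame.φ fr′) sl≡s) φ′s≡)))
          pure (x , ≡.subst (λ l → x ∉ F l) φ′s≡ x∉ ,
            lies-on H A′⊆H (λ H≡ → v∉H (≡.subst (λ l → v ∈ F l) (≡.sym H≡) (A⊆F j ∈-insertˡ))) ,
            λ {i} i≢0 i≢j → lies-on (φ i) (A′⊆F i≢0) (i≢j ∘ φ-injective))

        -- The face spanned by A, w₀ and w (suc j) has rank ∣ A ∣ + 2, hence no further
        -- vertex.
        other-end≡w : ∀ j {x} → x ∉ F (φ (suc j)) → (∀ {i} → i ≢ zero → i ≢ suc j → x ∈ F (φ i)) → x ≡ w (suc j)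
        other-end≡w j {x} x∉ x∈ = decidable-stable (x Fin.≟ w (suc j)) λ x≢w →
          ℕ.<⇒≱ (≡.subst (λ s → suc d ℕ.< t ℕ.+ s) (≡.sym (Q≡ x≢w))
            (≡.subst (ℕ._< t ℕ.+ (3 ℕ.+ suc (suc k))) q+k≡D (ℕ.≤-reflexive count)))
          (rank-bound P (L ∘ φ ∘ τ) (y ∘ τ) (diag ∘ τ) (λ i≢i′ → off (i≢i′ ∘ τ-injective)) {Q}
            (λ i x∈Q → ∈F⇒L≈0 P (Q⊆F i x∈Q)) (≡.subst (ℕ._≤ t ℕ.+ (suc (suc k) ℕ.+ suc (suc k))) q+k≡D D≤))
          where
          -- The indices other than `zero` and `suc j`: these `t` facets contain all of `Q`, one
          -- point too many for `rank-bound`.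
          τ : Fin t → Fin (suc (suc t))
          τ i = suc (punchIn j i)
          τ-injective : Injective _≡_ _≡_ τ
          τ-injective {i} {i′} eq = Fin.punchIn-injective j i i′ (Fin.suc-injective eq)
          τ≢ : ∀ i → τ i ≢ suc j
          τ≢ i eq = Fin.punchInᵢ≢i j i (Fin.suc-injective eq)
          Q : Subset n
          Q = insert x (insert (w (suc j)) (insert w₀ A))
          Q⊆F : ∀ i {p} → p ∈ Q → p ∈ F (φ (τ i))
          Q⊆F i p∈Q with ∈-insert⁻ p∈Q
          ... | inj₁ ≡.refl = x∈ (λ ()) (τ≢ i)
          ... | inj₂ p∈Q₁ with ∈-insert⁻ p∈Q₁
          ...   | inj₁ ≡.refl = w∈F (τ≢ i)
          ...   | inj₂ p∈Q₂ with ∈-insert⁻ p∈Q₂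
          ...     | inj₁ ≡.refl = w∈F λ ()
          ...     | inj₂ p∈A    = A⊆F (τ i) p∈A
          w∉Q₂ : w (suc j) ∉ insert w₀ A
          w∉Q₂ w∈ with ∈-insert⁻ w∈
          ... | inj₁ w≡w₀ with () ← w-injective w≡w₀
          ... | inj₂ w∈A  = w∉A (suc j) w∈A
          x∉Q₁ : x ≢ w (suc j) → x ∉ insert (w (suc j)) (insert w₀ A)
          x∉Q₁ x≢w x∈Q₁ with ∈-insert⁻ x∈Q₁
          ... | inj₁ x≡w = x≢w x≡w
          ... | inj₂ x∈Q₂ with ∈-insert⁻ x∈Q₂
          ...   | inj₁ ≡.refl = x∉ (w∈F λ ())
          ...   | inj₂ x∈A    = x∉ (A⊆F (suc j) x∈A)
          Q≡ : x ≢ w (suc j) → ∣ Q ∣ ≡ 3 ℕ.+ suc (suc k)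
          Q≡ x≢w = ≡.trans (∣insert∣ (x∉Q₁ x≢w)) (≡.cong suc (≡.trans (∣insert∣ w∉Q₂)
            (≡.cong suc (≡.trans (∣insert∣ (w∉A zero)) (≡.cong suc A≡)))))
          count : suc (suc (suc t) ℕ.+ suc (suc k)) ≡ t ℕ.+ (3 ℕ.+ suc (suc k))
          count = ≡.trans (≡.cong (ℕ._+ suc (suc k)) (ℕ.+-comm 3 t)) (ℕ.+-assoc t 3 _)
          -- A k-set has at least two elements here, so t + 2 + k ≤ t + 2k.
          D≤ : suc (suc t) ℕ.+ suc (suc k) ℕ.≤ t ℕ.+ (suc (suc k) ℕ.+ suc (suc k))
          D≤ = ≡.subst (ℕ._≤ t ℕ.+ (suc (suc k) ℕ.+ suc (suc k))) (≡.trans (≡.sym (ℕ.+-assoc t 2 (suc (suc k)))) (≡.cong (ℕ._+ suc (suc k)) (ℕ.+-comm t 2)))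
            (ℕ.+-monoʳ-≤ t (ℕ.+-monoˡ-≤ (suc (suc k)) (ℕ.s≤s (ℕ.s≤s ℕ.z≤n))))

        w∈H : ∀ i → w i ∈ F H
        w∈H zero    = A′⊆H ∈-insertˡ
        w∈H (suc j) = decidable-stable (w (suc j) ∈? F H) λ w∉H →
          other-end {suc j} (λ ()) λ (x , x∉ , x∈H , x∈) →
          w∉H (≡.subst (_∈ F H) (other-end≡w j x∉ x∈) x∈H)

        module _ {u} (u∉ : u ∉ insertAll w A) where

          Q : Subset n
          Q = insert u (insertAll w A)

          outside-E : ∀ {p} → p ∈ Q → p ≡ u ⊎ p ≡ v ⊎ (∃ λ i → p ≡ w i) ⊎ p ∈ E
          outside-E p∈Q with ∈-insert⁻ p∈Q
          ... | inj₁ p≡u = inj₁ p≡u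
          ... | inj₂ p∈ with ∈-insertAll⁻ w p∈
          ...   | inj₂ p≡w = inj₂ (inj₂ (inj₁ p≡w))
          ...   | inj₁ p∈A with ∈-insert⁻ p∈A
          ...     | inj₁ p≡v = inj₂ (inj₁ p≡v)
          ...     | inj₂ p∈E = inj₂ (inj₂ (inj₂ p∈E))

          module _ {c} (supp : ∀ p → p ∉ Q → c p ≈ 0#) (dep : Dependency X c) (0≤cᵤ : 0# ≤ c u) where

            -- Within `Q` only `u` and `w i` can lie off `F (φ i)`, so a nonnegative coefficient at
            -- `w i` is zero.
            w≤0 : ∀ i → c (w i) ≤ 0#
            w≤0 i with total 0# (c (w i))
            ... | inj₂ ≤0 = ≤0
            ... | inj₁ 0≤ = ≤-reflexive (supports-sign P (L (φ i)) (L-supports (φ i)) dep nonneg (w i) (w∉F i))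
              where
              nonneg : ∀ p → p ∉ F (φ i) → 0# ≤ c p
              nonneg p p∉ with p ∈? Q
              ... | no p∉Q = ≤-reflexive (sym (supp p p∉Q))
              ... | yes p∈Q with outside-E p∈Q
              ...   | inj₁ ≡.refl = 0≤cᵤ
              ...   | inj₂ (inj₁ ≡.refl) = contradiction (A⊆F i ∈-insertˡ) p∉
              ...   | inj₂ (inj₂ (inj₂ p∈E)) = contradiction (A⊆F i (∈-insertʳ p∈E)) p∉
              ...   | inj₂ (inj₂ (inj₁ (j , ≡.refl))) with i Fin.≟ j
              ...     | yes ≡.refl = 0≤
              ...     | no  i≢j    = contradiction (w∈F i≢j) p∉

            -- The same with `H`, off which only `u` and `v` can lie because of `w∈H`.
            v≤0 : c v ≤ 0#
            v≤0 with total 0# (c v)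
            ... | inj₂ ≤0 = ≤0
            ... | inj₁ 0≤ = ≤-reflexive (supports-sign P (L H) (L-supports H) dep nonneg v v∉H)
              where
              nonneg : ∀ p → p ∉ F H → 0# ≤ c p
              nonneg p p∉ with p ∈? Q
              ... | no p∉Q = ≤-reflexive (sym (supp p p∉Q))
              ... | yes p∈Q with outside-E p∈Q
              ...   | inj₁ ≡.refl = 0≤cᵤ
              ...   | inj₂ (inj₁ ≡.refl) = 0≤
              ...   | inj₂ (inj₂ (inj₂ p∈E)) = contradiction (A′⊆H (∈-insertʳ p∈E)) p∉
              ...   | inj₂ (inj₂ (inj₁ (j , ≡.refl))) = contradiction (w∈H j) p∉

            u∉E : u ∉ E
            u∉E u∈E = u∉ (A⊆insertAll w (∈-insertʳ u∈E))
              where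
              A⊆insertAll : ∀ {l} (w : Fin l → Fin n) → A ⊆ insertAll w A
              A⊆insertAll {zero}  w x∈A = x∈A
              A⊆insertAll {suc l} w x∈A = ∈-insertʳ (A⊆insertAll (w ∘ suc) x∈A)

            -- `E` has one element less than `A`, which leaves room for `u`: neighborliness applies
            -- to `insert u E`, and off it no coefficient is positive.
            trivial : ∀ p → c p ≈ 0#
            trivial p = -x≈0⇒x≈0 (nonneg-off-small P {insert u E}
              (ℕ.≤-reflexive (≡.trans (∣insert∣ u∉E) (≡.cong suc E≡))) (negate-dependency {X = X} dep) nonneg p)
              where
              nonneg : ∀ p → p ∉ insert u E → 0# ≤ - c p
              nonneg p p∉ with p ∈? Q
              ... | no p∉Q = ≤-reflexive (sym (x≈0⇒-x≈0 (supp p p∉Q)))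
              ... | yes p∈Q with outside-E p∈Q
              ...   | inj₁ ≡.refl = contradiction ∈-insertˡ p∉
              ...   | inj₂ (inj₁ ≡.refl) = 0≤-x v≤0
              ...   | inj₂ (inj₂ (inj₂ p∈E)) = contradiction (∈-insertʳ p∈E) p∉
              ...   | inj₂ (inj₂ (inj₁ (j , ≡.refl))) = 0≤-x (w≤0 j)

          no-dependency : ¬ DependentOn X Q
          no-dependency (c , supp , (p , cₚ≉0) , dep) with total 0# (c u)
          ... | inj₁ 0≤cᵤ = cₚ≉0 (trivial supp dep 0≤cᵤ p)
          ... | inj₂ cᵤ≤0 = -x≉0 cₚ≉0 (trivial (λ p p∉Q → x≈0⇒-x≈0 (supp p p∉Q))
            (negate-dependency {X = X} dep) (0≤-x cᵤ≤0) p)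

          ∣Q∣ : ∣ Q ∣ ≡ suc (suc d)
          ∣Q∣ = ≡.trans (∣insert∣ u∉) (≡.cong suc W≡)

      no-further-point : ¬ suc d ℕ.< n
      no-further-point D<n = contradiction-from (neighborly A′ A′≡)
        where
        contradiction-from : ¬ ∃ λ h → Supports X h A′
        contradiction-from (h , valid , exact) =
          -- The face of `A′` has no vertex besides `A′`, so some facet through it misses `v`.
          facet-avoiding P h valid (X v) (v∉A′ ∘ to (exact v)) λ (H , ⊆H , Lv≉0) →
          let
            A′⊆H : A′ ⊆ F H
            A′⊆H x∈ = ⊆H _ (from (exact _) x∈)
            v∉H : v ∉ F H
            v∉H = Lv≉0 ∘ ∈F⇒L≈0 P
            u , u∉ = ∣∣<n⇒∃∉ (insertAll w A) (≡.subst (ℕ._< n) (≡.sym W≡) D<n)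
          in dependent X (Q A′⊆H v∉H u∉) (≡.subst (suc d ℕ.<_) (≡.sym (∣Q∣ A′⊆H v∉H u∉)) ℕ.≤-refl)
               (no-dependency A′⊆H v∉H u∉)

    n≤D : n ℕ.≤ suc d
    n≤D = decidable-stable (n ℕ.≤? suc d) λ n≰D →
      let
        D<n = ℕ.≰⇒> n≰D
        E , _ , _ , E≡ = interpolate ⊥ ⊤ (λ _ → ∈⊤) (≡.subst (ℕ._≤ suc k) (≡.sym (∣⊥∣≡0 n)) ℕ.z≤n)
          (≡.subst (suc k ℕ.≤_) (≡.sym (∣⊤∣≡n n)) (ℕ.<⇒≤ k+1<n))
        v , v∉E = ∣∣<n⇒∃∉ E (≡.subst (ℕ._< n) (≡.sym E≡) k+1<n)
        A≡ = ≡.trans (∣insert∣ v∉E) (≡.cong suc E≡)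
      in frame P A≡ (suc (suc t)) (ℕ.≤-reflexive q+k≡D) λ fr →
         ¬¬-∀ (edge A≡ fr) λ edges → Corner.no-further-point E≡ v∉E fr edges D<n
      where
      k+1<n : suc k ℕ.< n
      k+1<n = ℕ.<⇒≤ (NeighborlyPolytope.k<n P)

open import Level using (Level)
open import Data.Nat using (ℕ; suc; _*_; _<_; _≤_; _∸_)
open import Data.Fin using (Fin)
open import Data.Fin.Subset using (Subset)
open import Data.List using (List; length)
open import Data.List.Membership.Propositional using (_∈_)
open import Data.List.Relation.Unary.Unique.Propositional using (Unique)
open import Data.Product using (_×_)
open import Function.Bundles using (_⇔_)
open import Relation.Binary.PropositionalEquality using (_≡_)

-- Passage from affine to homogeneous coordinates.

module Homogenisation {c ℓ₁ ℓ₂} (K : OrderedField c ℓ₁ ℓ₂) {n d : ℕ} (V : Fin n → Polytopes.Point K d) where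

  open import Data.Fin using (zero; suc)
  import Data.Fin.Properties as Fin
  open import Data.Fin.Subset using () renaming (_∈_ to _∈ˢ_)
  open import Data.Fin.Subset.Properties using (_∈?_)
  open import Data.List using (lookup)
  open import Data.List.Membership.Propositional.Properties using (∈-lookup)
  open import Data.List.Relation.Unary.Any using (index)
  open import Data.List.Relation.Unary.Any.Properties using (lookup-index)
  open import Data.Nat using (zero)
  open import Data.Product using (∃; _,_; proj₁; proj₂)
  open import Data.Vec.Functional using () renaming (_∷_ to _◂_)
  open import Function using (_∘_)
  open import Function.Bundles using (mk⇔; Equivalence)
  open import Relation.Binary.PropositionalEquality as ≡ using ()
  open import Relation.Binary.Structures using (IsTotalOrder)

  open LinearAlgebra K
  open Geometry K
  open Polytopes K
  open Equivalence using (to; from)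
  open OrderedField K hiding (zero; _*_; _≤_)
  module K = OrderedField K
  open IsTotalOrder isTotalOrder using (≤-respʳ-≈)
  open import Algebra.Properties.Ring ring
  open import Algebra.Properties.Semiring.Sum semiring

  X : Fin n → Fin (suc d) → Carrier
  X i = 1# ◂ V i

  Σ≡sum : ∀ {m} (f : Fin m → Carrier) → Σ[ f ] ≡ sum f
  Σ≡sum {zero}  f = ≡.refl
  Σ≡sum {suc m} f = ≡.cong (f zero +_) (Σ≡sum (f ∘ suc))

  Σ≈sum : ∀ {m} (f : Fin m → Carrier) → Σ[ f ] ≈ sum f
  Σ≈sum f = reflexive (Σ≡sum f)

  affine⇒independent : ∀ {r} (g : Fin r → Fin n) → AffinelyIndependent (V ∘ g) → Independent (X ∘ g)
  affine⇒independent g ind c dep = ind c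
    (trans (Σ≈sum c) (trans (sum-cong-≋ (λ i → sym (*-identityʳ (c i)))) (dep zero)))
    (λ j → trans (Σ≈sum (λ i → c i K.* V (g i) j)) (dep (suc j)))

  independent⇒affine : ∀ {r} (g : Fin r → Fin n) → Independent (X ∘ g) → AffinelyIndependent (V ∘ g)
  independent⇒affine g ind c Σc≈0 Σcx≈0 = ind c λ where
    zero    → trans (trans (sum-cong-≋ (λ i → *-identityʳ (c i))) (sym (Σ≈sum c))) Σc≈0
    (suc j) → trans (sym (Σ≈sum (λ i → c i K.* V (g i) j))) (Σcx≈0 j)

  -- The homogeneous functional of a valid inequality is its slack.
  normal-• : ∀ a b v → (b ◂ negate a) • X v ≈ b - a · V v
  normal-• a b v = +-cong (*-identityʳ b)
    (trans (negate-• a (V v)) (-‿cong (sym (Σ≈sum (λ j → a j K.* V v j)))))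

  face⇒supports : ∀ {S} → IsFaceSet V S → ∃ λ h → Supports X h S
  face⇒supports (a , b , a≤b , exact) = (b ◂ negate a) ,
    (λ v → ≤-respʳ-≈ (sym (normal-• a b v)) (0≤y-x (a≤b v))) ,
    λ v → mk⇔
      (λ h≈0 → to (exact v) (sym (x∙y⁻¹≈ε⇒x≈y b _ (trans (sym (normal-• a b v)) h≈0))))
      (λ v∈S → trans (normal-• a b v) (x≈y⇒x∙y⁻¹≈ε (sym (from (exact v) v∈S))))

  supports⇒face : ∀ {h S} → Supports X h S → IsFaceSet V S
  supports⇒face {h} (valid , exact) = a , h zero ,
    (λ v → 0≤y-x⇒x≤y (≤-respʳ-≈ (h• v) (valid v))) ,
    λ v → mk⇔
      (λ a≈b → to (exact v) (trans (h• v) (x≈y⇒x∙y⁻¹≈ε (sym a≈b))))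
      (λ v∈S → sym (x∙y⁻¹≈ε⇒x≈y (h zero) _ (trans (sym (h• v)) (from (exact v) v∈S))))
    where
    a : Point d
    a = negate (h ∘ suc)
    h• : ∀ v → h • X v ≈ h zero - a · V v
    h• v = +-cong (*-identityʳ _) (sym (trans
      (-‿cong (trans (Σ≈sum (λ j → a j K.* V v j)) (negate-• (h ∘ suc) (V v)))) (-‿involutive _)))

  module _ {k} (k<n : k < n) (fullDim : FullDim V) (neighborly : Neighborly V k)
    (facets : List (Subset n)) (isFacets : ∀ S → IsFacet V S ⇔ S ∈ facets) where

    neighborlyPolytope : NeighborlyPolytope X k (length facets)
    neighborlyPolytope = record
      { k<n        = k<n
      ; neighborly = λ S S≡k → face⇒supports (neighborly S S≡k)
      ; base       = proj₁ fullDim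
      ; base-indep = affine⇒independent (proj₁ fullDim) (proj₂ (proj₂ (proj₂ fullDim)))
      ; F          = lookup facets
      ; L          = λ j → proj₁ (face⇒supports (proj₁ (facet j)))
      ; L-supports = λ j → proj₂ (face⇒supports (proj₁ (facet j)))
      ; proper     = λ j → Fin.¬∀⟶∃¬ n (_∈ˢ lookup facets j) (_∈? lookup facets j) λ all∈ →
          let g , inj , _ , ind = fullDim in
          proj₂ (proj₂ (facet j)) (g , inj , (λ t → all∈ (g t)) , ind)
      ; complete   = λ {h} {S} supp (v , v∉S) b inj b∈S ind →
          let
            S∈facets = to (isFacets S)
              ( supports⇒face {h} supp
              , (b , inj , b∈S , independent⇒affine b ind)
              -- With `d + 1` independent points in `S`, `h` would vanish at every vertex, including
              -- `v`.
              , λ (g , _ , g∈S , g-ind) → zero-on-basis {b = X ∘ g} h (affine⇒independent g g-ind)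
                  (λ i → from (proj₂ supp (g i)) (g∈S i)) (X v) (v∉S ∘ to (proj₂ supp v)))
          in index S∈facets , ≡.sym (lookup-index S∈facets)
      }
      where
      facet : ∀ j → IsFacet V (lookup facets j)
      facet j = from (isFacets _) (∈-lookup j)

theorem2 : ∀ {c ℓ₁ ℓ₂ : Level} (K : OrderedField c ℓ₁ ℓ₂) (k d n : ℕ)
    (V : Fin n → Polytopes.Point K d) →
    Polytopes.AllVertices K V → Polytopes.FullDim K V →
    Polytopes.Neighborly K V k → 2 * k < d → d ≤ 3 * k ∸ 1 →
    (facets : List (Subset n)) → Unique facets →
    (∀ S → Polytopes.IsFacet K V S ⇔ S ∈ facets) →
    n ≤ length facets × (length facets ≡ n → n ≡ suc d)
-- For k ≤ 1 no `d` satisfies both bounds; at k = 0 the truncated subtraction leaves d ≤ 0.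
theorem2 K 0 (suc d) n V _ _ _ _ () _ _ _
theorem2 K 1 d n V _ _ _ 2<d d≤2 _ _ _ = contradiction d≤2 (<⇒≱ 2<d)
  where
  open import Data.Nat.Properties using (<⇒≱)
  open import Relation.Nullary using (contradiction)
theorem2 K k@(suc (suc k′)) d n V _ fullDim neighborly 2k<d d≤3k-1 facets _ isFacets =
  points≤blocks k≤q rich (<⇒≤ k<n) ,
  λ m≡n → ≤-antisym (NoFurtherPoint.n≤D P q+k≡D (containing-small k≤q rich (≤-reflexive m≡n))) D≤n
  where
  open import Data.Fin.Properties using (injective⇒≤)
  open import Data.Fin.Subset using (∣_∣; _⊆_)
  open import Data.Nat using (_+_; s≤s)
  open import Data.Nat.Properties
  open import Data.Product using (∃; _,_; proj₁; proj₂)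
  open import Relation.Binary.PropositionalEquality using (refl; sym; trans; cong)
  open import Relation.Nullary using (¬_)
  open DoubleNegation
  open Geometry K

  k+k≡2k : 2 * k ≡ k + k
  k+k≡2k = cong (k +_) (+-identityʳ k)

  D≤n : suc d ≤ n
  D≤n = injective⇒≤ (proj₁ (proj₂ fullDim))

  D≤3k : suc d ≤ k + (k + k)
  D≤3k = ≤-trans (s≤s d≤3k-1) (≤-reflexive (cong (k +_) k+k≡2k))

  k+2+k≤D : k + (2 + k) ≤ suc d
  k+2+k≤D = ≤-trans (≤-reflexive (trans (+-suc k (suc k)) (cong suc (trans (+-suc k k) (cong suc (sym k+k≡2k)))))) (s≤s 2k<d)

  -- `2k < d` gives D - k ≥ k + 2, so D - k has the form `suc (suc t)`; the equality case sets two
  -- of the D - k facets aside and keeps `t`.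
  t : ℕ
  t = suc d ∸ (2 + k)

  q+k≡D : suc (suc t) + k ≡ suc d
  q+k≡D = trans (sym (trans (+-suc t (suc k)) (cong suc (+-suc t k)))) (m∸n+n≡m (≤-trans (m≤n+m (2 + k) k) k+2+k≤D))

  k≤q : k ≤ suc (suc t)
  k≤q = ≤-trans (m+n≤o⇒m≤o∸n k k+2+k≤D) (m≤n+m t 2)

  k<n : k < n
  k<n = ≤-trans (≤-trans (≤-trans (n≤1+n (suc k)) (m≤n+m (2 + k) k)) k+2+k≤D) D≤n

  P : NeighborlyPolytope (Homogenisation.X K V) k (length facets)
  P = Homogenisation.neighborlyPolytope K V k<n fullDim neighborly facets isFacets

  open FiniteSets.DoubleCounting (NeighborlyPolytope.F P)

  rich : ∀ A → ∣ A ∣ ≡ k → ¬ ¬ ∃ λ B → suc (suc t) ≤ ∣ B ∣ × B ⊆ containing A ×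
    (∀ T → T ⊆ B → ∣ T ∣ ≡ k → ∣ common T ∣ ≤ suc (suc t))
  rich A A≡k = do
    fr ← frame P {A} A≡k (suc (suc t)) (≤-reflexive q+k≡D)
    pure (frame-counting P q+k≡D D≤3k {A} fr)
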